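{- For every 2-connected partial $k$-tree $G$, $\mathrm{lct}(G)\leq k-1$.
   Context: All graphs are finite and simple. A $k$-tree is defined recursively: the complete graph on $k$ vertices is a $k$-tree, and any graph obtained from a $k$-tree by adding a new vertex adjacent to exactly the vertices of an existing $k$-clique is a $k$-tree. A partial $k$-tree is a subgraph of a $k$-tree (equivalently, a graph of treewidth at most $k$). $\mathrm{lct}(G)$ is the minimum cardinality of a set of vertices that intersects every longest cycle (cycle of maximum length) of $G$. -}

module Defs where

open import Level using (0ℓ) renaming (suc to lsuc)
open import Data.Empty using (⊥)
open import Data.Fin using (Fin; zero; suc; punchIn)
open import Data.Fin.Properties using (_≟_; all?; injective⇒≤)
open import Data.Fin.Subset using (Subset; ∣_∣; _∈_; _∉_; ⊤)
open import Data.Fin.Subset.Properties using (_∈?_; ∈⊤; anySubset?)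
open import Data.List using (List; []; _∷_; _∷ʳ_; length; lookup)
open import Data.List.Membership.Propositional.Properties using (∈-lookup)
open import Data.List.Relation.Unary.All as All using ()
open import Data.List.Relation.Unary.AllPairs using (_∷_; allPairs?)
open import Data.List.Relation.Unary.Any as Any using (Any; here)
open import Data.List.Relation.Unary.Linked using (Linked; linked?)
open import Data.List.Relation.Unary.Unique.Propositional using (Unique)
open import Data.Nat as ℕ using (ℕ; zero; suc; _≤_; _<_; z≤n; s≤s; _≤?_)
open import Data.Product using (Σ-syntax; ∃-syntax; _×_; _,_; proj₁; proj₂)
open import Function using (_∘_; _⇔_; Injective)
open import Relation.Binary using (Rel; Decidable; Symmetric)
open import Relation.Binary.Construct.Closure.ReflexiveTransitive using (Star)
open import Relation.Binary.PropositionalEquality using (_≡_; _≢_; refl; sym; cong)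
open import Relation.Nullary using (¬_; Dec; yes; no; contradiction)
open import Relation.Nullary.Decidable using (map′; ¬?; _×-dec_; _→-dec_)
import Relation.Unary as U

record Graph (n : ℕ) : Set (lsuc 0ℓ) where
  infix 4 _~_ _~?_
  field
    _~_      : Rel (Fin n) 0ℓ
    _~?_     : Decidable _~_
    ~-sym    : Symmetric _~_
    ~-irrefl : ∀ {u} → ¬ (u ~ u)

module _ {n : ℕ} (G : Graph n) where
  open Graph G

  IsComplete : Set
  IsComplete = ∀ u v → u ≢ v → u ~ v

  IsClique : Subset n → Set
  IsClique Q = ∀ {u v} → u ∈ Q → v ∈ Q → u ≢ v → u ~ v

  AdjacentOutside : Subset n → Rel (Fin n) 0ℓ
  AdjacentOutside X u v = u ~ v × u ∉ X × v ∉ X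

  -- G - X is connected.
  ConnectedMinus : Subset n → Set
  ConnectedMinus X = ∀ u v → u ∉ X → v ∉ X → Star (AdjacentOutside X) u v

  IsKConnected : ℕ → Set
  IsKConnected c = c < n × (∀ X → ∣ X ∣ < c → ConnectedMinus X)

  -- A cycle is listed by its vertices, each once, in cyclic order from an
  -- arbitrary starting point; its length is the length of the list.
  IsCycle : List (Fin n) → Set
  IsCycle []       = ⊥
  IsCycle (x ∷ xs) = 3 ≤ length (x ∷ xs) × Unique (x ∷ xs) × Linked _~_ (x ∷ xs ∷ʳ x)

  IsLongestCycle : List (Fin n) → Set
  IsLongestCycle c = IsCycle c × (∀ d → IsCycle d → length d ≤ length c)

  IsLongestCycleTransversal : Subset n → Set
  IsLongestCycleTransversal S = ∀ c → IsLongestCycle c → Any (_∈ S) c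

  HasTransversalOfSize : ℕ → Set
  HasTransversalOfSize m = ∃[ S ] IsLongestCycleTransversal S × ∣ S ∣ ≡ m

Is2Connected : ∀ {n} → Graph n → Set
Is2Connected G = IsKConnected G 2

-- The new vertex v may carry any label, so that the class of k-trees is
-- closed under isomorphism; punchIn v embeds the old vertices as those
-- different from v.
data IsKTree (k : ℕ) : ∀ {n} → Graph n → Set (lsuc 0ℓ) where
  complete : {G : Graph k} → IsComplete G → IsKTree k G
  extend   : ∀ {n} {H : Graph n} {G : Graph (suc n)} → IsKTree k H →
             (v : Fin (suc n)) (Q : Subset n) → IsClique H Q → ∣ Q ∣ ≡ k →
             (∀ i j → Graph._~_ G (punchIn v i) (punchIn v j) ⇔ Graph._~_ H i j) →
             (∀ i → Graph._~_ G v (punchIn v i) ⇔ i ∈ Q) →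
             IsKTree k G

-- The vertex sets are Fin n and Fin m, so the inclusion of vertex sets is an
-- injection.
IsSubgraphOf : ∀ {n m} → Graph n → Graph m → Set
IsSubgraphOf {n} {m} G H =
  Σ[ f ∈ (Fin n → Fin m) ] Injective _≡_ _≡_ f ×
    (∀ {u v} → Graph._~_ G u v → Graph._~_ H (f u) (f v))

IsPartialKTree : ∀ {n} → ℕ → Graph n → Set (lsuc 0ℓ)
IsPartialKTree k G = ∃[ m ] Σ[ H ∈ Graph m ] IsKTree k H × IsSubgraphOf G H

IsLeast : (ℕ → Set) → ℕ → Set
IsLeast P m = P m × (∀ j → P j → m ≤ j)

least : {P : ℕ → Set} → U.Decidable P → ∀ b → P b → ∃[ m ] IsLeast P m
least P? zero    Pb = zero , Pb , λ _ _ → z≤n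
least P? (suc b) Pb with P? zero
... | yes P0 = zero , P0 , λ _ _ → z≤n
... | no ¬P0 with least (P? ∘ suc) b Pb
...   | m , Pm , min = suc m , Pm , λ where
        zero    P0 → contradiction P0 ¬P0
        (suc j) Pj → s≤s (min j Pj)

lookup-injective : ∀ {A : Set} {xs : List A} → Unique xs → Injective _≡_ _≡_ (lookup xs)
lookup-injective (_ ∷ _)   {zero}  {zero}  _  = refl
lookup-injective (px ∷ _)  {zero}  {suc j} eq = contradiction eq (All.lookup px (∈-lookup j))
lookup-injective (px ∷ _)  {suc i} {zero}  eq = contradiction (sym eq) (All.lookup px (∈-lookup i))
lookup-injective (_ ∷ pxs) {suc i} {suc j} eq = cong suc (lookup-injective pxs eq)

allLists? : ∀ {n} {P : List (Fin n) → Set} → U.Decidable P →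
            ∀ b → Dec (∀ xs → length xs ≤ b → P xs)
allLists? P? zero    = map′ (λ { p [] _ → p }) (λ f → f [] z≤n) (P? [])
allLists? P? (suc b) =
  map′ (λ { (p , q) [] _ → p ; (p , q) (x ∷ xs) (s≤s le) → q x xs le })
       (λ f → f [] z≤n , λ x xs le → f (x ∷ xs) (s≤s le))
       (P? [] ×-dec all? (λ x → allLists? (P? ∘ (x ∷_)) b))

module _ {n : ℕ} (G : Graph n) where
  open Graph G

  isCycle? : U.Decidable (IsCycle G)
  isCycle? []       = no λ ()
  isCycle? (x ∷ xs) =
    (3 ≤? length (x ∷ xs)) ×-dec allPairs? (λ u v → ¬? (u ≟ v)) (x ∷ xs)
      ×-dec linked? _~?_ (x ∷ xs ∷ʳ x)

  cycle-length≤n : ∀ c → IsCycle G c → length c ≤ n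
  cycle-length≤n (x ∷ xs) (_ , uniq , _) = injective⇒≤ (lookup-injective uniq)

  isLongestCycle? : U.Decidable (IsLongestCycle G)
  isLongestCycle? c = isCycle? c ×-dec
    map′ (λ f d cyc → f d (cycle-length≤n d cyc) cyc) (λ f d _ → f d)
         (allLists? (λ d → isCycle? d →-dec (length d ≤? length c)) n)

  isTransversal? : U.Decidable (IsLongestCycleTransversal G)
  isTransversal? S =
    map′ (λ f c lc → f c (cycle-length≤n c (proj₁ lc)) lc) (λ f c _ → f c)
         (allLists? (λ c → isLongestCycle? c →-dec Any.any? (_∈? S) c) n)

  hasTransversalOfSize? : U.Decidable (HasTransversalOfSize G)
  hasTransversalOfSize? m = anySubset? (λ S → isTransversal? S ×-dec (∣ S ∣ ℕ.≟ m))

  ⊤-transversal : IsLongestCycleTransversal G ⊤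
  ⊤-transversal (_ ∷ _) _ = here ∈⊤

  leastTransversalSize : ∃[ m ] IsLeast (HasTransversalOfSize G) m
  leastTransversalSize = least hasTransversalOfSize? ∣ ⊤ {n} ∣ (⊤ , ⊤-transversal , refl)

  lct : ℕ
  lct = proj₁ leastTransversalSize

  lct-isLeast : IsLeast (HasTransversalOfSize G) lct
  lct-isLeast = proj₂ leastTransversalSize

{-# OPTIONS --safe #-}
module Submission where

-- Two longest cycles C, D of a 2-connected graph share two vertices: otherwise
-- two disjoint walks join C to D (one of them trivial if C and D share a
-- vertex), and together with the longer arcs of C and D between their ends they
-- form a longer cycle.
--
-- Suppose no k - 1 vertices meet all longest cycles.  Peel the vertices v off
-- the k-tree one by one: v and the parts attached to it become one part,
-- attached to the k-clique Q of v.  As long as no longest cycle lies in a part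
-- plus one vertex of its clique, every longest cycle meets the remaining k-tree
-- twice; this fails at the final k-clique, where some longest cycle avoids k - 1
-- vertices.  So at some v a longest cycle lies in the new part plus one vertex
-- of Q.  No longest cycle then lies in the complementary part plus one vertex.
-- In the bag B = Q + v, every part misses a vertex, and for all a, b in B some
-- longest cycle meets B exactly in a and b.  Its two arcs run through parts
-- missing w₁ and w₂, and a longest cycle meeting B in w₁ and w₂ (in w₁ and a if
-- w₁ = w₂) uses no such part, so the two share at most one vertex.

open import Defs
open import Level using (0ℓ)
open import Data.Bool using (true; false)
open import Data.Empty using (⊥; ⊥-elim)
open import Data.Fin using (Fin; zero; suc; punchIn; punchOut)
import Data.Fin.Properties as Fin
open import Data.Fin.Subset using (Subset; ⁅_⁆; ∣_∣) renaming (⊥ to ∅; ⊤ to full; _∈_ to _∈ₛ_; _∉_ to _∉ₛ_; _-_ to _∖_)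
import Data.Fin.Subset.Properties as Subset
open import Data.List using (List; []; _∷_; _++_; _∷ʳ_; length; map)
open import Data.List.Membership.Propositional using (find) renaming (_∈_ to _∈ₗ_; _∉_ to _∉ₗ_)
open import Data.List.Membership.Propositional.Properties using (∈-++⁺ˡ; ∈-++⁺ʳ; ∈-++⁻; ∈-map⁺)
open import Data.List.Properties using (length-++; ++-assoc)
open import Data.List.Relation.Binary.Disjoint.Propositional using (Disjoint)
open import Data.List.Relation.Binary.Permutation.Propositional using (_↭_; ↭-refl; ↭-sym; ↭-trans; ↭-prep; ↭-reflexive; ↭⇒↭ₛ)
open import Data.List.Relation.Binary.Permutation.Propositional.Properties using (∈-resp-↭; ↭-length; ++-comm; ∷↭∷ʳ)
import Data.List.Relation.Binary.Permutation.Setoid.Properties as Permₛ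
open import Data.List.Relation.Unary.All as All using (All; []; _∷_)
import Data.List.Relation.Unary.All.Properties as All
open import Data.List.Relation.Unary.AllPairs using ([]; _∷_)
open import Data.List.Relation.Unary.Any as Any using (Any; here; there)
open import Data.List.Relation.Unary.Linked using (Linked; [-]; _∷_)
open import Data.List.Relation.Unary.Unique.Propositional using (Unique)
import Data.List.Relation.Unary.Unique.Propositional.Properties as Unique
open import Data.Maybe using (Maybe; just; nothing)
open import Data.Nat using (ℕ; zero; suc; _+_; _≤_; _<_; _∸_; z≤n; s≤s)
import Data.Nat.Properties as ℕ
open import Data.Product using (∃-syntax; _×_; _,_; proj₁; proj₂)
open import Data.Sum as Sum using (_⊎_; inj₁; inj₂)
open import Data.Sum.Properties using (inj₁-injective)
open import Data.Vec as Vec using (_∷_)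
import Data.Vec.Properties as Vec
open import Function using (_∘_; _⇔_; Injective; Equivalence)
open import Relation.Binary using (Rel; Symmetric; DecidableEquality)
open import Relation.Binary.Construct.Closure.ReflexiveTransitive using (Star; ε; _◅_)
open import Relation.Binary.PropositionalEquality using (_≡_; _≢_; refl; sym; trans; cong; subst; setoid)
open import Relation.Nullary using (¬_; Dec; yes; no; contradiction)
open import Relation.Nullary.Decidable using (_×-dec_; ¬?)
open import Relation.Unary using (Pred; Decidable)

-- Repetition-free lists and walks.

private
  variable
    V : Set
    R : Rel V 0ℓ
    u v w : V
    xs ys : List V

unique-resp-↭ : xs ↭ ys → Unique xs → Unique ys
unique-resp-↭ p = Permₛ.Unique-resp-↭ (setoid _) (↭⇒↭ₛ p)

unique-++⁻ : ∀ (xs : List V) {ys} → Unique (xs ++ ys) → Unique xs × Unique ys × Disjoint xs ys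
unique-++⁻ []       ys! = [] , ys! , λ ()
unique-++⁻ (x ∷ xs) (x∉ ∷ xsys!) with unique-++⁻ xs xsys!
... | xs! , ys! , dis =
  All.++⁻ˡ xs x∉ ∷ xs! , ys! , λ where
    (here refl , e∈ys) → All.lookup (All.++⁻ʳ xs x∉) e∈ys refl
    (there e∈xs , e∈ys) → dis (e∈xs , e∈ys)

unique-head : Unique (u ∷ xs) → u ∉ₗ xs
unique-head (u∉ ∷ _) u∈ = All.lookup u∉ u∈ refl

unique-∷ : u ∉ₗ xs → Unique xs → Unique (u ∷ xs)
unique-∷ u∉ xs! = All.tabulate (λ { e∈ refl → u∉ e∈ }) ∷ xs!

-- The list of a walk omits its first vertex, so that its length counts edges
-- and a cycle is a closed walk without repetitions in its list.
data Walk {V : Set} (R : Rel V 0ℓ) : V → V → List V → Set where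
  []  : Walk R u u []
  _∷_ : R u w → Walk R w v xs → Walk R u v (w ∷ xs)

infixr 5 _++ʷ_
_++ʷ_ : Walk R u v xs → Walk R v w ys → Walk R u w (xs ++ ys)
[]      ++ʷ q = q
(r ∷ p) ++ʷ q = r ∷ (p ++ʷ q)

target∈ : Walk R u v xs → v ∈ₗ u ∷ xs
target∈ []      = here refl
target∈ (_ ∷ p) = there (target∈ p)

target∈-≢ : Walk R u v xs → u ≢ v → v ∈ₗ xs
target∈-≢ p u≢v with target∈ p
... | here refl = contradiction refl u≢v
... | there v∈  = v∈

splitWalk : Walk R u v xs → w ∈ₗ u ∷ xs →
            ∃[ ys ] ∃[ zs ] xs ≡ ys ++ zs × Walk R u w ys × Walk R w v zs
splitWalk p       (here refl) = [] , _ , refl , [] , p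
splitWalk (r ∷ p) (there w∈) with splitWalk p w∈
... | ys , zs , refl , p₁ , p₂ = _ ∷ ys , zs , refl , r ∷ p₁ , p₂

reverseWalk : Symmetric R → Walk R u v xs → ∃[ ys ] Walk R v u ys × (v ∷ ys ↭ u ∷ xs)
reverseWalk R-sym []      = [] , [] , ↭-refl
reverseWalk {u = u} {v = v} R-sym (r ∷ p) with reverseWalk R-sym p
... | ys , q , perm =
  ys ++ u ∷ [] , q ++ʷ (R-sym r ∷ []) , ↭-trans (++-comm (v ∷ ys) (u ∷ [])) (↭-prep u perm)

eraseLoops : DecidableEquality V → {R : Rel V 0ℓ} {u v : V} {xs : List V} → Walk R u v xs →
             ∃[ ys ] Walk R u v ys × Unique (u ∷ ys) × (∀ {e} → e ∈ₗ ys → e ∈ₗ xs)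
eraseLoops _≟_ []      = [] , [] , [] ∷ [] , λ ()
eraseLoops _≟_ {u = u} (_∷_ {w = w} r p) with eraseLoops _≟_ p
... | ys , q , ys! , ys⊆ with Any.any? (u ≟_) (w ∷ ys)
...   | no u∉ = w ∷ ys , r ∷ q , unique-∷ u∉ ys! , λ where
        (here e≡) → here e≡
        (there e∈) → there (ys⊆ e∈)
...   | yes u∈ with splitWalk q u∈
...     | pre , zs , refl , q₁ , q₂ with unique-++⁻ (w ∷ pre) ys!
...       | _ , zs! , dis = zs , q₂ , unique-∷ (λ u∈zs → dis (target∈ q₁ , u∈zs)) zs! ,
                            λ e∈ → there (ys⊆ (∈-++⁺ʳ pre e∈))

module _ {A : Pred V 0ℓ} (A? : Decidable A) where

  lastHit : Walk R u v xs → (∀ {e} → e ∈ₗ u ∷ xs → ¬ A e) ⊎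
            (∃[ a ] ∃[ pre ] ∃[ ys ] u ∷ xs ≡ pre ++ a ∷ ys × Walk R a v ys × A a ×
             (∀ {e} → e ∈ₗ ys → ¬ A e))
  lastHit {u = u} [] with A? u
  ... | yes Au = inj₂ (u , [] , [] , refl , [] , Au , λ ())
  ... | no ¬Au = inj₁ λ { (here refl) → ¬Au }
  lastHit {u = u} (r ∷ p) with lastHit p
  ... | inj₂ (a , pre , ys , eq , q , rest) = inj₂ (a , u ∷ pre , ys , cong (u ∷_) eq , q , rest)
  ... | inj₁ none with A? u
  ...   | yes Au = inj₂ (u , [] , _ , refl , r ∷ p , Au , none)
  ...   | no ¬Au = inj₁ λ { (here refl) → ¬Au ; (there e∈) → none e∈ }

  firstHit : Walk R u v xs → A v →
             ∃[ a ] ∃[ ys ] ∃[ zs ] xs ≡ ys ++ zs × Walk R u a ys × A a ×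
             (∀ {e} → e ∈ₗ u ∷ ys → A e → e ≡ a)
  firstHit {u = u} p Av with A? u
  firstHit {u = u} p Av | yes Au = u , [] , _ , refl , [] , Au , λ { (here e≡) _ → e≡ }
  firstHit [] Av | no ¬Au = contradiction Av ¬Au
  firstHit (r ∷ p) Av | no ¬Au with firstHit p Av
  ... | a , ys , zs , refl , q , Aa , only =
    a , _ ∷ ys , zs , refl , r ∷ q , Aa , λ where
      (here refl) Ae → contradiction Ae ¬Au
      (there e∈)  Ae → only e∈ Ae

-- Cutting at the last vertex in `A`, and from there on at the first vertex in `B`, leaves a walk
-- that touches the two sets only at its ends.
pruneWalk : {A B : Pred V 0ℓ} → Decidable A → Decidable B →
            Walk R u v xs → Unique (u ∷ xs) → A u → B v →
            ∃[ a ] ∃[ b ] ∃[ ys ] Walk R a b ys × Unique (a ∷ ys) × A a × B b ×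
            (∀ {e} → e ∈ₗ a ∷ ys → e ∈ₗ u ∷ xs) ×
            (∀ {e} → e ∈ₗ ys → ¬ A e × (B e → e ≡ b))
pruneWalk A? B? p uxs! Au Bv with lastHit A? p
... | inj₁ none = contradiction Au (none (here refl))
... | inj₂ (a , pre , ys , eq , q , Aa , noA) with firstHit B? q Bv
...   | b , zs , rest , refl , q′ , Bb , onlyB =
  a , b , zs , q′ , proj₁ (unique-++⁻ (a ∷ zs) (proj₁ (proj₂ (unique-++⁻ pre (subst Unique eq uxs!))))) ,
  Aa , Bb , (λ e∈ → subst (_ ∈ₗ_) (sym eq) (∈-++⁺ʳ pre (∈-++⁺ˡ e∈))) ,
  λ e∈ → noA (∈-++⁺ˡ e∈) , onlyB (there e∈)

-- Menger's theorem for two paths: a circuit through two given vertices.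

-- A single edge traversed back and forth counts as a circuit.
Circuit : Rel V 0ℓ → V → V → Set
Circuit R s y = ∃[ xs ] ∃[ ys ] Walk R s y xs × Walk R y s ys × Unique (xs ++ ys)

module _ (_≟_ : DecidableEquality V) {R : Rel V 0ℓ} (R-sym : Symmetric R)
         (avoid : ∀ a u v → u ≢ a → v ≢ a → ∃[ xs ] Walk R u v xs × a ∉ₗ xs) where

  -- A walk from z back to s avoiding y first meets the circuit in some r ≢ y;
  -- reroute the circuit from r to y through z, on the side not containing s.
  circuit-step : ∀ {s y z} → s ≢ y → y ≢ z → Circuit R s y → R y z → Circuit R s z
  circuit-step {s} {y} {z} s≢y y≢z (xs , ys , p , q , xy!) yz
    with avoid y z s (y≢z ∘ sym) s≢y
  ... | _ , t₀ , y∉t₀ with eraseLoops _≟_ t₀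
  ... | _ , t₁ , zt₁! , t₁⊆ with firstHit (λ e → Any.any? (e ≟_) (xs ++ ys)) t₁ (∈-++⁺ʳ xs (target∈-≢ q (s≢y ∘ sym)))
  ... | r , ts , rest , refl , t , r∈O , onlyr = go (∈-++⁻ xs r∈O)
    where
    zts! : Unique (z ∷ ts)
    zts! = proj₁ (unique-++⁻ (z ∷ ts) zt₁!)

    y∉zts : y ∉ₗ z ∷ ts
    y∉zts (here y≡z) = y≢z y≡z
    y∉zts (there y∈) = y∉t₀ (t₁⊆ (∈-++⁺ˡ y∈))

    r≢y : r ≢ y
    r≢y refl = y∉zts (target∈ t)

    xs! : Unique xs
    xs! = proj₁ (unique-++⁻ xs xy!)

    ys! : Unique ys
    ys! = proj₁ (proj₂ (unique-++⁻ xs xy!))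

    xs#ys : Disjoint xs ys
    xs#ys = proj₂ (proj₂ (unique-++⁻ xs xy!))

    y∈xs : y ∈ₗ xs
    y∈xs = target∈-≢ p s≢y

    go : r ∈ₗ xs ⊎ r ∈ₗ ys → Circuit R s z
    -- For `r` on the way out: go to `r`, take `t` backwards to `z`, then return over the edge to
    -- `y` and along `ys`.
    go (inj₁ r∈xs) with splitWalk p (there r∈xs)
    ... | xs₁ , xs₂ , refl , p₁ , p₂ with reverseWalk R-sym t
    ... | ts′ , t′ , perm =
      xs₁ ++ ts′ , y ∷ ys , p₁ ++ʷ t′ , R-sym yz ∷ q ,
      Unique.++⁺ (Unique.++⁺ xs₁! ts′! xs₁#ts′) (unique-∷ (λ y∈ys → xs#ys (y∈xs , y∈ys)) ys!) λ where
        (e∈ , here refl) → y∉ (∈-++⁻ xs₁ e∈)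
        (e∈ , there e∈ys) → old e∈ys (∈-++⁻ xs₁ e∈)
      where
      rts′! : Unique (r ∷ ts′)
      rts′! = unique-resp-↭ (↭-sym perm) zts!
      ts′! : Unique ts′
      ts′! with rts′!
      ... | _ ∷ ! = !
      xs₁! : Unique xs₁
      xs₁! = proj₁ (unique-++⁻ xs₁ xs!)
      new : ∀ {e} → e ∈ₗ ts′ → e ∉ₗ (xs₁ ++ xs₂) ++ ys
      new e∈ e∈O with onlyr (∈-resp-↭ perm (there e∈)) e∈O
      ... | refl = unique-head rts′! e∈
      xs₁#ts′ : Disjoint xs₁ ts′
      xs₁#ts′ (e∈ , e∈′) = new e∈′ (∈-++⁺ˡ (∈-++⁺ˡ e∈))
      y∉ : y ∈ₗ xs₁ ⊎ y ∈ₗ ts′ → ⊥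
      y∉ (inj₁ y∈) = proj₂ (proj₂ (unique-++⁻ xs₁ xs!)) (y∈ , target∈-≢ p₂ r≢y)
      y∉ (inj₂ y∈) = y∉zts (∈-resp-↭ perm (there y∈))
      old : ∀ {e} → e ∈ₗ ys → e ∈ₗ xs₁ ⊎ e ∈ₗ ts′ → ⊥
      old e∈ys (inj₁ e∈) = xs#ys (∈-++⁺ˡ e∈ , e∈ys)
      old e∈ys (inj₂ e∈) = new e∈ (∈-++⁺ʳ (xs₁ ++ xs₂) e∈ys)
    go (inj₂ r∈ys) with splitWalk q (there r∈ys)
    ... | ys₁ , ys₂ , refl , q₁ , q₂ =
      xs ++ z ∷ [] , ts ++ ys₂ , p ++ʷ (yz ∷ []) , t ++ʷ q₂ ,
      subst Unique (sym (++-assoc xs (z ∷ []) (ts ++ ys₂)))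
        (Unique.++⁺ xs! (Unique.++⁺ zts! ys₂! zts#ys₂) λ (e∈xs , e∈) → old e∈xs (∈-++⁻ (z ∷ ts) e∈))
      where
      r∈ys₁ : r ∈ₗ ys₁
      r∈ys₁ = target∈-≢ q₁ (r≢y ∘ sym)
      ys₂! : Unique ys₂
      ys₂! = proj₁ (proj₂ (unique-++⁻ ys₁ ys!))
      zts#ys₂ : Disjoint (z ∷ ts) ys₂
      zts#ys₂ (e∈ , e∈′) with onlyr e∈ (∈-++⁺ʳ xs (∈-++⁺ʳ ys₁ e∈′))
      ... | refl = proj₂ (proj₂ (unique-++⁻ ys₁ ys!)) (r∈ys₁ , e∈′)
      old : ∀ {e} → e ∈ₗ xs → e ∈ₗ z ∷ ts ⊎ e ∈ₗ ys₂ → ⊥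
      old e∈xs (inj₂ e∈) = xs#ys (e∈xs , ∈-++⁺ʳ ys₁ e∈)
      old e∈xs (inj₁ e∈) with onlyr e∈ (∈-++⁺ˡ e∈xs)
      ... | refl = xs#ys (e∈xs , r∈ys)

  -- The circuit is extended edge by edge along the walk; the alternative `s ≡ y` covers the start
  -- and every return to `s`.
  circuit-along : ∀ {s y t xs} → s ≡ y ⊎ Circuit R s y → Walk R y t xs → s ≡ t ⊎ Circuit R s t
  circuit-along c [] = c
  circuit-along {s} {y} c (_∷_ {w = z} yz p) with s ≟ z | y ≟ z | s ≟ y
  ... | yes s≡z | _        | _        = circuit-along (inj₁ s≡z) p
  ... | no _    | yes refl | _        = circuit-along c p
  ... | no s≢z  | no _     | yes refl = circuit-along (inj₂ (z ∷ [] , s ∷ [] , yz ∷ [] , R-sym yz ∷ [] ,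
                                          unique-∷ (λ { (here z≡s) → s≢z (sym z≡s) }) (unique-∷ (λ ()) []))) p
  circuit-along c (yz ∷ p) | no _ | no y≢z | no s≢y with c
  ... | inj₁ s≡y = contradiction s≡y s≢y
  ... | inj₂ cir = circuit-along (inj₂ (circuit-step s≢y y≢z cir yz)) p

-- Cycles as closed walks; two longest cycles share two vertices.

linked⇒walk : ∀ {x y} (xs : List V) → Linked R (x ∷ xs ∷ʳ y) → Walk R x y (xs ∷ʳ y)
linked⇒walk []       (r ∷ [-]) = r ∷ []
linked⇒walk (_ ∷ xs) (r ∷ rs)  = r ∷ linked⇒walk xs rs

walk⇒linked : Walk R u v xs → R v w → Linked R (u ∷ xs ∷ʳ w)
walk⇒linked []      vw = vw ∷ [-]
walk⇒linked (r ∷ p) vw = r ∷ walk⇒linked p vw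

data Augmented (n : ℕ) : Set where
  source sink : Augmented n
  inner       : Fin n → Augmented n

_≟ᵃ_ : ∀ {n} → DecidableEquality (Augmented n)
source  ≟ᵃ source  = yes refl
source  ≟ᵃ sink    = no λ ()
source  ≟ᵃ inner _ = no λ ()
sink    ≟ᵃ source  = no λ ()
sink    ≟ᵃ sink    = yes refl
sink    ≟ᵃ inner _ = no λ ()
inner _ ≟ᵃ source  = no λ ()
inner _ ≟ᵃ sink    = no λ ()
inner u ≟ᵃ inner v with u Fin.≟ v
... | yes refl = yes refl
... | no u≢v   = no λ { refl → u≢v refl }

module _ {n : ℕ} (G : Graph n) where
  open Graph G

  _∈?ₗ_ : ∀ (u : Fin n) xs → Dec (u ∈ₗ xs)
  u ∈?ₗ xs = Any.any? (u Fin.≟_) xs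

  cycle-unique : ∀ {c} → IsCycle G c → Unique c
  cycle-unique {_ ∷ _} (_ , c! , _) = c!

  cycle-length : ∀ {c} → IsCycle G c → 3 ≤ length c
  cycle-length {_ ∷ _} (3≤ , _) = 3≤

  cycle⇒walk : ∀ {c u} → IsCycle G c → u ∈ₗ c → ∃[ xs ] Walk _~_ u u xs × xs ↭ c
  cycle⇒walk {x ∷ xs} (_ , _ , lnk) u∈ with splitWalk (linked⇒walk xs lnk) (∈-++⁺ˡ {ys = x ∷ []} u∈)
  ... | ys , zs , eq , p , q =
    zs ++ ys , q ++ʷ p , ↭-trans (++-comm zs ys) (↭-trans (↭-reflexive (sym eq)) (↭-sym (∷↭∷ʳ x xs)))

  walk⇒cycle : ∀ {u xs} → Walk _~_ u u xs → Unique xs → 3 ≤ length xs → IsCycle G xs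
  walk⇒cycle (r ∷ p) xs! 3≤ = 3≤ , xs! , walk⇒linked p r

  cycle-vertex : ∀ {c} → IsCycle G c → ∃[ x ] x ∈ₗ c
  cycle-vertex {x ∷ _} _ = x , here refl

  cycle-other : ∀ {c} → IsCycle G c → ∀ x → ∃[ y ] y ∈ₗ c × y ≢ x
  cycle-other {y ∷ z ∷ _} (_ , c! , _) x with y Fin.≟ x
  ... | no y≢x   = y , here refl , y≢x
  ... | yes refl = z , there (here refl) , λ { refl → unique-head c! (here refl) }
  cycle-other {_ ∷ []} (s≤s () , _)

  -- As `xs` omits `a`, its length counts edges. The last conjunct says that the arc has at least
  -- half the edges of `c`, with doubling in place of division.
  LongArc : List (Fin n) → Fin n → Fin n → Set
  LongArc c a b = ∃[ xs ] Walk _~_ a b xs × Unique (a ∷ xs) × (∀ {e} → e ∈ₗ a ∷ xs → e ∈ₗ c) ×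
                  length c ≤ length xs + length xs

  longArc : ∀ {c a b} → IsCycle G c → a ∈ₗ c → b ∈ₗ c → a ≢ b → LongArc c a b
  longArc {c} {a} {b} cyc a∈ b∈ a≢b with cycle⇒walk cyc a∈
  ... | _ , p , perm with splitWalk p (there (∈-resp-↭ (↭-sym perm) b∈))
  ... | xs , ys , refl , p₁ , p₂ = choose (ℕ.≤-total (length ys) (length xs))
    where
    a∈ys : a ∈ₗ ys
    a∈ys = target∈-≢ p₂ (a≢b ∘ sym)
    b∈xs : b ∈ₗ xs
    b∈xs = target∈-≢ p₁ a≢b
    parts : Unique xs × Unique ys × Disjoint xs ys
    parts = unique-++⁻ xs (unique-resp-↭ (↭-sym perm) (cycle-unique cyc))
    xs#ys : Disjoint xs ys
    xs#ys = proj₂ (proj₂ parts)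
    len : length c ≡ length xs + length ys
    len = trans (↭-length (↭-sym perm)) (length-++ xs)
    choose : length ys ≤ length xs ⊎ length xs ≤ length ys → LongArc c a b
    choose (inj₁ ys≤xs) =
      xs , p₁ , unique-∷ (λ a∈xs → xs#ys (a∈xs , a∈ys)) (proj₁ parts) ,
      (λ { (here refl) → a∈ ; (there e∈) → ∈-resp-↭ perm (∈-++⁺ˡ e∈) }) ,
      ℕ.≤-trans (ℕ.≤-reflexive len) (ℕ.+-monoʳ-≤ (length xs) ys≤xs)
    choose (inj₂ xs≤ys) with reverseWalk ~-sym p₂
    ... | zs , q , perm′ =
      zs , q , unique-resp-↭ (↭-sym perm′) (unique-∷ (λ b∈ys → xs#ys (b∈xs , b∈ys)) (proj₁ (proj₂ parts))) ,
      (λ e∈ → inC (∈-resp-↭ perm′ e∈)) ,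
      subst (λ l → length c ≤ l + l) (ℕ.suc-injective (sym (↭-length perm′)))
        (ℕ.≤-trans (ℕ.≤-reflexive len) (ℕ.+-monoˡ-≤ (length ys) xs≤ys))
      where
      inC : ∀ {e} → e ∈ₗ b ∷ ys → e ∈ₗ c
      inC (here refl) = b∈
      inC (there e∈)  = ∈-resp-↭ perm (∈-++⁺ʳ xs e∈)

  -- The longer arcs of C and D, joined by the two walks, form a longer cycle.
  -- The walk from d₁ to c₁ may be empty; it is when C and D meet in c₁ ≡ d₁.
  no-linkage : ∀ {C D c₁ c₂ d₁ d₂ P₁ P₂} → IsLongestCycle G C → IsLongestCycle G D →
               c₁ ∈ₗ C → c₂ ∈ₗ C → c₁ ≢ c₂ → d₁ ∈ₗ D → d₂ ∈ₗ D → d₁ ≢ d₂ →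
               Walk _~_ c₂ d₂ P₂ → Walk _~_ d₁ c₁ P₁ → c₂ ≢ d₂ →
               Unique P₂ → Unique P₁ → Disjoint P₂ P₁ →
               (∀ {e} → e ∈ₗ P₂ → e ∉ₗ C × (e ∈ₗ D → e ≡ d₂)) →
               (∀ {e} → e ∈ₗ P₁ → e ∉ₗ D × (e ∈ₗ C → e ≡ c₁)) →
               (∀ {e} → e ∈ₗ C → e ∈ₗ D → e ≡ c₁) → ⊥
  no-linkage {C} {D} {c₁} {c₂} {d₁} {d₂} {P₁} {P₂} (cycC , maxC) (cycD , maxD)
             c₁∈ c₂∈ c₁≢c₂ d₁∈ d₂∈ d₁≢d₂ p₂ p₁ c₂≢d₂ P₂! P₁! P₂#P₁ offP₂ offP₁ meet
    with longArc cycC c₁∈ c₂∈ c₁≢c₂ | longArc cycD d₂∈ d₁∈ (d₁≢d₂ ∘ sym)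
  ... | X , x , c₁X! , X⊆ , C≤ | Z , z , d₂Z! , Z⊆ , D≤ =
    ℕ.<⇒≱ longer (maxC _ (walk⇒cycle (x ++ʷ p₂ ++ʷ z ++ʷ p₁) new! (ℕ.≤-trans (cycle-length cycC) (ℕ.<⇒≤ longer))))
    where
    tail! : ∀ {u : Fin n} {us} → Unique (u ∷ us) → Unique us
    tail! (_ ∷ us!) = us!
    C≡D : length C ≡ length D
    C≡D = ℕ.≤-antisym (maxD C cycC) (maxC D cycD)
    new = X ++ P₂ ++ Z ++ P₁
    Z#P₁ : Disjoint Z P₁
    Z#P₁ (e∈ , e∈′) = proj₁ (offP₁ e∈′) (Z⊆ (there e∈))
    P₂# : Disjoint P₂ (Z ++ P₁)
    P₂# (e∈ , e∈′) with ∈-++⁻ Z e∈′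
    ... | inj₂ e∈P₁ = P₂#P₁ (e∈ , e∈P₁)
    ... | inj₁ e∈Z with proj₂ (offP₂ e∈) (Z⊆ (there e∈Z))
    ...   | refl = unique-head d₂Z! e∈Z
    X# : Disjoint X (P₂ ++ Z ++ P₁)
    X# (e∈ , e∈′) with ∈-++⁻ P₂ e∈′
    ... | inj₁ e∈P₂ = proj₁ (offP₂ e∈P₂) (X⊆ (there e∈))
    ... | inj₂ e∈″ with ∈-++⁻ Z e∈″
    ...   | inj₁ e∈Z with meet (X⊆ (there e∈)) (Z⊆ (there e∈Z))
    ...     | refl = unique-head c₁X! e∈
    X# (e∈ , e∈′) | inj₂ e∈″ | inj₂ e∈P₁ with proj₂ (offP₁ e∈P₁) (X⊆ (there e∈))
    ...     | refl = unique-head c₁X! e∈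
    new! : Unique new
    new! = Unique.++⁺ (tail! c₁X!) (Unique.++⁺ P₂! (Unique.++⁺ (tail! d₂Z!) P₁! Z#P₁) P₂#) X#
    -- The two arcs alone guarantee only the length of `C`; the nonempty `P₂` makes the new cycle
    -- strictly longer.
    0<P₂ : 0 < length P₂
    0<P₂ = nonempty p₂ c₂≢d₂
      where
      nonempty : ∀ {u v us} → Walk _~_ u v us → u ≢ v → 0 < length us
      nonempty []      u≢u = contradiction refl u≢u
      nonempty (_ ∷ _) _   = s≤s z≤n
    X+Z<new : length X + length Z < length new
    X+Z<new = begin-strict
      length X + length Z                              <⟨ ℕ.+-monoʳ-< (length X) (ℕ.+-monoˡ-≤ (length Z) 0<P₂) ⟩
      length X + (length P₂ + length Z)                ≤⟨ ℕ.+-monoʳ-≤ (length X) (ℕ.+-monoʳ-≤ (length P₂) (ℕ.m≤m+n (length Z) (length P₁))) ⟩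
      length X + (length P₂ + (length Z + length P₁)) ≡⟨ cong (λ l → length X + (length P₂ + l)) (length-++ Z) ⟨
      length X + (length P₂ + length (Z ++ P₁))       ≡⟨ cong (length X +_) (length-++ P₂) ⟨
      length X + length (P₂ ++ Z ++ P₁)               ≡⟨ length-++ X ⟨
      length new                                       ∎
      where open ℕ.≤-Reasoning
    -- `C` and `D` are equally long, so twice the shorter of the two arcs already bounds `length C`.
    longer : length C < length new
    longer with ℕ.≤-total (length X) (length Z)
    ... | inj₁ X≤Z = ℕ.≤-<-trans (ℕ.≤-trans C≤ (ℕ.+-monoʳ-≤ (length X) X≤Z)) X+Z<new
    ... | inj₂ Z≤X = ℕ.≤-<-trans (ℕ.≤-trans (ℕ.≤-trans (ℕ.≤-reflexive C≡D) D≤) (ℕ.+-monoˡ-≤ (length Z) Z≤X)) X+Z<new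

  star⇒walk : ∀ {X u v} → Star (AdjacentOutside G X) u v →
              ∃[ xs ] Walk _~_ u v xs × (∀ {e} → e ∈ₗ xs → e ∉ₛ X)
  star⇒walk ε = [] , [] , λ ()
  star⇒walk ((uv , _ , v∉) ◅ st) with star⇒walk st
  ... | xs , p , off = _ ∷ xs , uv ∷ p , λ { (here refl) → v∉ ; (there e∈) → off e∈ }

  module _ (conn : Is2Connected G) where

    walk-any : ∀ u v → ∃[ xs ] Walk _~_ u v xs
    walk-any u v with star⇒walk (proj₂ conn ∅ (ℕ.≤-trans (s≤s (ℕ.≤-reflexive (Subset.∣⊥∣≡0 n))) (s≤s z≤n)) u v Subset.∉⊥ Subset.∉⊥)
    ... | xs , p , _ = xs , p

    walk-avoiding : ∀ x u v → u ≢ x → v ≢ x → ∃[ xs ] Walk _~_ u v xs × x ∉ₗ xs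
    walk-avoiding x u v u≢x v≢x
      with star⇒walk (proj₂ conn ⁅ x ⁆ (s≤s (ℕ.≤-reflexive (Subset.∣⁅x⁆∣≡1 x))) u v
                        (Subset.x≢y⇒x∉⁅y⁆ u≢x) (Subset.x≢y⇒x∉⁅y⁆ v≢x))
    ... | xs , p , off = xs , p , λ x∈ → off x∈ (Subset.x∈⁅x⁆ x)

    -- A walk from `C` to `D` avoiding `x`, once pruned, is one link; the empty walk at `x` is the
    -- other.
    single-meet : ∀ {C D x} → IsLongestCycle G C → IsLongestCycle G D → x ∈ₗ C → x ∈ₗ D →
                  ¬ (∀ {e} → e ∈ₗ C → e ∈ₗ D → e ≡ x)
    single-meet {C} {D} {x} LC LD x∈C x∈D meet
      with cycle-other (proj₁ LC) x | cycle-other (proj₁ LD) x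
    ... | c , c∈ , c≢x | d , d∈ , d≢x with walk-avoiding x c d c≢x d≢x
    ... | _ , p₀ , x∉₀ with eraseLoops Fin._≟_ p₀
    ... | xs , p , cxs! , xs⊆ with pruneWalk (_∈?ₗ C) (_∈?ₗ D) p cxs! c∈ d∈
    ... | c₂ , d₂ , P , q , (_ ∷ P!) , c₂∈ , d₂∈ , P⊆ , off =
      no-linkage LC LD x∈C c₂∈ x≢c₂ x∈D d₂∈ x≢d₂ q [] c₂≢d₂ P! [] (λ ()) off (λ ()) meet
      where
      x∉ : x ∉ₗ c ∷ xs
      x∉ (here x≡c) = c≢x (sym x≡c)
      x∉ (there x∈) = x∉₀ (xs⊆ x∈)
      x≢c₂ : x ≢ c₂
      x≢c₂ refl = x∉ (P⊆ (here refl))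
      x≢d₂ : x ≢ d₂
      x≢d₂ refl = x∉ (P⊆ (target∈ q))
      c₂≢d₂ : c₂ ≢ d₂
      c₂≢d₂ refl = x≢c₂ (sym (meet c₂∈ d₂∈))

  module _ (C D : List (Fin n)) where

    -- A source joined to every vertex of C and a sink joined to every vertex
    -- of D: a circuit through both is a pair of disjoint walks from C to D.
    Adjᵃ : Rel (Augmented n) 0ℓ
    Adjᵃ (inner u) (inner v) = u ~ v
    Adjᵃ source    (inner c) = c ∈ₗ C
    Adjᵃ (inner c) source    = c ∈ₗ C
    Adjᵃ sink      (inner d) = d ∈ₗ D
    Adjᵃ (inner d) sink      = d ∈ₗ D
    Adjᵃ _         _         = ⊥

    Adjᵃ-sym : Symmetric Adjᵃ
    Adjᵃ-sym {inner _} {inner _} uv = ~-sym uv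
    Adjᵃ-sym {source}  {inner _} c∈ = c∈
    Adjᵃ-sym {inner _} {source}  c∈ = c∈
    Adjᵃ-sym {sink}    {inner _} d∈ = d∈
    Adjᵃ-sym {inner _} {sink}    d∈ = d∈

    innerWalk : ∀ {u v xs} → Walk _~_ u v xs → Walk Adjᵃ (inner u) (inner v) (map inner xs)
    innerWalk []      = []
    innerWalk (r ∷ p) = r ∷ innerWalk p

    -- Extracts from a walk in the augmented graph its initial stretch inside `G`, up to the first
    -- `source` or `sink`.
    leaveInner : ∀ {u t xs} → Walk Adjᵃ (inner u) t xs → (∀ y → t ≢ inner y) →
                 ∃[ v ] ∃[ ps ] ∃[ w ] ∃[ rest ] Walk _~_ u v ps × Adjᵃ (inner v) w ×
                 xs ≡ map inner ps ++ w ∷ rest × (∀ y → w ≢ inner y)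
    leaveInner [] t≢ = contradiction refl (t≢ _)
    leaveInner {u} (_∷_ {w = source} r p)  t≢ = u , [] , source , _ , [] , r , refl , λ _ ()
    leaveInner {u} (_∷_ {w = sink} r p)    t≢ = u , [] , sink , _ , [] , r , refl , λ _ ()
    leaveInner     (_∷_ {w = inner w} r p) t≢ with leaveInner p t≢
    ... | v , ps , t , rest , q , a , refl , t≢′ = v , w ∷ ps , t , rest , r ∷ q , a , refl , t≢′

    module _ (conn : Is2Connected G) (cycC : IsCycle G C) (cycD : IsCycle G D) where

      -- Reduces avoidance in the augmented graph to avoidance in `G`: a cycle has a vertex other
      -- than `a`, through which `source` or `sink` is reached.
      anchor : ∀ a u → u ≢ a → ∃[ y ] inner y ≢ a × (u ≡ inner y ⊎ Adjᵃ u (inner y))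
      anchor a         (inner y) y≢a = y , y≢a , inj₁ refl
      anchor source    source    u≢a = contradiction refl u≢a
      anchor sink      sink      u≢a = contradiction refl u≢a
      anchor source    sink      _   with cycle-vertex cycD
      ... | d , d∈ = d , (λ ()) , inj₂ d∈
      anchor sink      source    _   with cycle-vertex cycC
      ... | c , c∈ = c , (λ ()) , inj₂ c∈
      anchor (inner x) source    _   with cycle-other cycC x
      ... | c , c∈ , c≢x = c , (λ { refl → c≢x refl }) , inj₂ c∈
      anchor (inner x) sink      _   with cycle-other cycD x
      ... | d , d∈ , d≢x = d , (λ { refl → d≢x refl }) , inj₂ d∈

      inner-avoiding : ∀ a u v → inner u ≢ a → inner v ≢ a →
                       ∃[ xs ] Walk Adjᵃ (inner u) (inner v) xs × a ∉ₗ xs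
      inner-avoiding (inner x) u v u≢ v≢ with walk-avoiding conn x u v (u≢ ∘ cong inner) (v≢ ∘ cong inner)
      ... | xs , p , x∉ = map inner xs , innerWalk p , λ a∈ → x∉ (unmap a∈)
        where
        unmap : ∀ {y ys} → inner y ∈ₗ map inner ys → y ∈ₗ ys
        unmap {ys = _ ∷ _} (here refl) = here refl
        unmap {ys = _ ∷ _} (there e∈)  = there (unmap e∈)
      inner-avoiding source u v _ _ with walk-any conn u v
      ... | xs , p = map inner xs , innerWalk p , notInner xs
        where
        notInner : ∀ ys → source ∉ₗ map inner ys
        notInner (_ ∷ ys) (there e∈) = notInner ys e∈
      inner-avoiding sink u v _ _ with walk-any conn u v
      ... | xs , p = map inner xs , innerWalk p , notInner xs
        where
        notInner : ∀ ys → sink ∉ₗ map inner ys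
        notInner (_ ∷ ys) (there e∈) = notInner ys e∈

      avoidᵃ : ∀ a u v → u ≢ a → v ≢ a → ∃[ xs ] Walk Adjᵃ u v xs × a ∉ₗ xs
      avoidᵃ a u v u≢ v≢ with anchor a u u≢ | anchor a v v≢
      ... | y , y≢ , yu | z , z≢ , zv with inner-avoiding a y z y≢ z≢
      ... | xs , p , a∉ = attach (start yu) zv
        where
        start : u ≡ inner y ⊎ Adjᵃ u (inner y) → ∃[ ys ] Walk Adjᵃ u (inner z) ys × a ∉ₗ ys
        start (inj₁ refl) = xs , p , a∉
        start (inj₂ r)    = inner y ∷ xs , r ∷ p , λ { (here refl) → y≢ refl ; (there a∈) → a∉ a∈ }
        attach : ∃[ ys ] Walk Adjᵃ u (inner z) ys × a ∉ₗ ys → v ≡ inner z ⊎ Adjᵃ v (inner z) →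
                 ∃[ ys ] Walk Adjᵃ u v ys × a ∉ₗ ys
        attach q                (inj₁ refl) = q
        attach (ys , q , a∉ys) (inj₂ r) = ys ++ v ∷ [] , q ++ʷ (Adjᵃ-sym {v} r ∷ []) , λ a∈ → off (∈-++⁻ ys a∈)
          where
          off : ¬ (a ∈ₗ ys ⊎ a ∈ₗ v ∷ [])
          off (inj₁ a∈)          = a∉ys a∈
          off (inj₂ (here refl)) = v≢ refl

      source-sink-circuit : Circuit Adjᵃ source sink
      source-sink-circuit with cycle-vertex cycC
      -- The avoided vertex is arbitrary; all that is needed is some walk from `source` to `sink`.
      ... | x , _ with avoidᵃ (inner x) source sink (λ ()) (λ ())
      ... | _ , p , _ with circuit-along _≟ᵃ_ (λ {x} → Adjᵃ-sym {x}) avoidᵃ (inj₁ refl) p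
      ... | inj₂ c = c

  -- Deleting `source` and `sink` from a circuit through both leaves two disjoint walks between `C`
  -- and `D`, which prune to a linkage.
  disjoint-longest : ∀ {C D} → Is2Connected G → IsLongestCycle G C → IsLongestCycle G D → ¬ Disjoint C D
  disjoint-longest {C} {D} conn LC LD C#D
    with source-sink-circuit C D conn (proj₁ LC) (proj₁ LD)
  ... | (inner c ∷ xs) , (inner d ∷ ys) , c∈ ∷ p , d∈ ∷ q , xy!
    with leaveInner C D p (λ _ ()) | leaveInner C D q (λ _ ())
  ... | _ , _ , inner _ , _ , _ , _ , _ , w≢ | _ = contradiction refl (w≢ _)
  ... | _ | _ , _ , inner _ , _ , _ , _ , _ , w≢ = contradiction refl (w≢ _)
  -- The outward half cannot pass `source`, where the return half ends; likewise the return half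
  -- cannot pass `sink`.
  ... | _ , ps , source , _ , _ , _ , refl , _ | _ =
    ⊥-elim (proj₂ (proj₂ (unique-++⁻ (inner c ∷ xs) xy!))
      (there (∈-++⁺ʳ (map inner ps) (here refl)) , there (target∈-≢ q (λ ()))))
  ... | _ | _ , qs , sink , _ , _ , _ , refl , _ =
    ⊥-elim (proj₂ (proj₂ (unique-++⁻ (inner c ∷ xs) xy!))
      (there (target∈-≢ p (λ ())) , there (∈-++⁺ʳ (map inner qs) (here refl))))
  ... | d′ , ps , sink , rest , p′ , d′∈ , refl , _ | c′ , qs , source , rest′ , q′ , c′∈ , refl , _
    with unique-++⁻ (map inner (c ∷ ps) ++ sink ∷ rest) xy!
  ... | px! , qy! , pq#
    with pruneWalk (_∈?ₗ C) (_∈?ₗ D) p′ (Unique.map⁻ (proj₁ (unique-++⁻ (map inner (c ∷ ps)) px!))) c∈ d′∈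
       | pruneWalk (_∈?ₗ D) (_∈?ₗ C) q′ (Unique.map⁻ (proj₁ (unique-++⁻ (map inner (d ∷ qs)) qy!))) d∈ c′∈
  ... | c₂ , d₂ , P₂ , w₂ , (_ ∷ P₂!) , c₂∈ , d₂∈ , P₂⊆ , off₂
      | d₁ , c₁ , P₁ , w₁ , (_ ∷ P₁!) , d₁∈ , c₁∈ , P₁⊆ , off₁ =
    no-linkage LC LD c₁∈ c₂∈ (λ { refl → apart (here refl) (target∈ w₁) })
      d₁∈ d₂∈ (λ { refl → apart (target∈ w₂) (here refl) }) w₂ w₁ (λ { refl → C#D (c₂∈ , d₂∈) })
      P₂! P₁! (λ (e∈ , e∈′) → apart (there e∈) (there e∈′)) off₂ off₁
      (λ e∈C e∈D → ⊥-elim (C#D (e∈C , e∈D)))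
    where
    apart : ∀ {e} → e ∈ₗ c₂ ∷ P₂ → e ∉ₗ d₁ ∷ P₁
    apart e∈ e∈′ = pq# (∈-++⁺ˡ (∈-map⁺ inner (P₂⊆ e∈)) , ∈-++⁺ˡ (∈-map⁺ inner (P₁⊆ e∈′)))

  longest-cycles-meet-twice : ∀ {C D} → Is2Connected G → IsLongestCycle G C → IsLongestCycle G D →
                              ∃[ x ] ∃[ y ] x ≢ y × (x ∈ₗ C × x ∈ₗ D) × (y ∈ₗ C × y ∈ₗ D)
  longest-cycles-meet-twice {C} {D} conn LC LD with Any.any? (_∈?ₗ D) C
  ... | no none = ⊥-elim (disjoint-longest conn LC LD λ (e∈C , e∈D) → none (Any.map (λ { refl → e∈D }) e∈C))
  ... | yes some with find some
  ... | x , x∈C , x∈D with Any.any? (λ y → (y ∈?ₗ D) ×-dec ¬? (x Fin.≟ y)) C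
  ... | yes other with find other
  ...   | y , y∈C , y∈D , x≢y = x , y , x≢y , (x∈C , x∈D) , (y∈C , y∈D)
  longest-cycles-meet-twice {C} {D} conn LC LD | yes some | x , x∈C , x∈D | no none =
    ⊥-elim (single-meet conn LC LD x∈C x∈D same)
    where
    same : ∀ {e} → e ∈ₗ C → e ∈ₗ D → e ≡ x
    same {e} e∈C e∈D with x Fin.≟ e
    ... | yes refl = refl
    ... | no x≢e   = contradiction (Any.map (λ { refl → e∈D , x≢e }) e∈C) none

-- Cardinalities of finite subsets.

preimage : ∀ {n m} → (Fin n → Fin m) → Subset m → Subset n
preimage f S = Vec.tabulate (Vec.lookup S ∘ f)

∈-preimage⁺ : ∀ {n m} (f : Fin n → Fin m) {S i} → f i ∈ₛ S → i ∈ₛ preimage f S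
∈-preimage⁺ f {i = i} fi∈ =
  Vec.lookup⇒[]= i _ (trans (Vec.lookup∘tabulate _ i) (Vec.[]=⇒lookup fi∈))

∈-preimage⁻ : ∀ {n m} (f : Fin n → Fin m) {S i} → i ∈ₛ preimage f S → f i ∈ₛ S
∈-preimage⁻ f {S} {i} i∈ =
  Vec.lookup⇒[]= (f i) S (trans (sym (Vec.lookup∘tabulate _ i)) (Vec.[]=⇒lookup i∈))

∣preimage∣≤ : ∀ {n m} (f : Fin n → Fin m) → Injective _≡_ _≡_ f → ∀ S → ∣ preimage f S ∣ ≤ ∣ S ∣
∣preimage∣≤ {zero}  f f-inj S = z≤n
∣preimage∣≤ {suc n} f f-inj S with Vec.lookup S (f zero) in eq
... | false = ∣preimage∣≤ (f ∘ suc) (Fin.suc-injective ∘ f-inj) S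
-- By injectivity the other indices map into `S` without `f zero`, a strictly smaller set.
... | true  = ℕ.≤-<-trans
  (ℕ.≤-trans (Subset.p⊆q⇒∣p∣≤∣q∣ shrink) (∣preimage∣≤ (f ∘ suc) (Fin.suc-injective ∘ f-inj) (S ∖ f zero)))
  (Subset.x∈p⇒∣p-x∣<∣p∣ (Vec.lookup⇒[]= (f zero) S eq))
  where
  shrink : ∀ {i} → i ∈ₛ preimage (f ∘ suc) S → i ∈ₛ preimage (f ∘ suc) (S ∖ f zero)
  shrink i∈ = ∈-preimage⁺ (f ∘ suc) {S = S ∖ f zero}
    (Subset.x∈p∧x≢y⇒x∈p-y {p = S} (∈-preimage⁻ (f ∘ suc) i∈) (λ fi≡f0 → Fin.0≢1+n (sym (f-inj fi≡f0))))

∣insertAt-outside∣ : ∀ {n} (S : Subset n) v → ∣ Vec.insertAt S v false ∣ ≡ ∣ S ∣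
∣insertAt-outside∣ S           zero    = refl
∣insertAt-outside∣ (false ∷ S) (suc v) = ∣insertAt-outside∣ S v
∣insertAt-outside∣ (true ∷ S)  (suc v) = cong suc (∣insertAt-outside∣ S v)

∣insertAt-inside∣ : ∀ {n} (S : Subset n) v → ∣ Vec.insertAt S v true ∣ ≡ suc ∣ S ∣
∣insertAt-inside∣ S           zero    = refl
∣insertAt-inside∣ (false ∷ S) (suc v) = ∣insertAt-inside∣ S v
∣insertAt-inside∣ (true ∷ S)  (suc v) = cong suc (∣insertAt-inside∣ S v)

∈-insertAt⁺ : ∀ {n} (S : Subset n) v b {i} → i ∈ₛ S → punchIn v i ∈ₛ Vec.insertAt S v b
∈-insertAt⁺ S v b {i} i∈ =
  Vec.lookup⇒[]= (punchIn v i) _ (trans (Vec.insertAt-punchIn S v b i) (Vec.[]=⇒lookup i∈))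

smaller-misses : ∀ {n} (S T : Subset n) → ∣ S ∣ < ∣ T ∣ → ∃[ w ] w ∈ₛ T × w ∉ₛ S
smaller-misses S T S<T with Fin.any? (λ w → (w Subset.∈? T) ×-dec ¬? (w Subset.∈? S))
... | yes found = found
... | no none   = contradiction (Subset.p⊆q⇒∣p∣≤∣q∣ T⊆S) (ℕ.<⇒≱ S<T)
  where
  T⊆S : ∀ {w} → w ∈ₛ T → w ∈ₛ S
  T⊆S {w} w∈T with w Subset.∈? S
  ... | yes w∈S = w∈S
  ... | no w∉S  = contradiction (w , w∈T , w∉S) none

punchIn-view : ∀ {n} (v i : Fin (suc n)) → i ≡ v ⊎ (∃[ j ] i ≡ punchIn v j)
punchIn-view v i with v Fin.≟ i
... | yes refl = inj₁ refl
... | no v≢i   = inj₂ (punchOut v≢i , sym (Fin.punchIn-punchOut v≢i))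

-- Covers by a vertex set and mutually non-adjacent parts.

module _ {n : ℕ} (G : Graph n) where
  open Graph G

  -- Every vertex of G is either identified with an element of V or lies in a
  -- part labelled by L; parts are pairwise non-adjacent, and the neighbours in
  -- V of the part ℓ satisfy att ℓ.
  record Cover (V L : Set) (att : L → V → Set) : Set where
    field
      cls      : Fin n → V ⊎ L
      cls-inj  : ∀ {x y i} → cls x ≡ inj₁ i → cls y ≡ inj₁ i → x ≡ y
      attached : ∀ {x y i ℓ} → x ~ y → cls x ≡ inj₁ i → cls y ≡ inj₂ ℓ → att ℓ i
      same     : ∀ {x y ℓ ℓ′} → x ~ y → cls x ≡ inj₂ ℓ → cls y ≡ inj₂ ℓ′ → ℓ ≡ ℓ′

    Labelled : Fin n → Set
    Labelled x = ∃[ ℓ ] cls x ≡ inj₂ ℓ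

    Confined : L → V → List (Fin n) → Set
    Confined ℓ i c = ∀ {x} → x ∈ₗ c → cls x ≡ inj₂ ℓ ⊎ (cls x ≡ inj₁ i × att ℓ i)

    -- The invariant kept while peeling. If a cycle has no vertex in `V`, the `i` in `Confined` is
    -- arbitrary.
    Small : Set
    Small = ∀ ℓ i c → IsLongestCycle G c → ¬ Confined ℓ i c

    inside-or-labelled : ∀ x → (∃[ i ] cls x ≡ inj₁ i) ⊎ Labelled x
    inside-or-labelled x with cls x
    ... | inj₁ i = inj₁ (i , refl)
    ... | inj₂ ℓ = inj₂ (ℓ , refl)

    inside≢labelled : ∀ {x i ℓ} → cls x ≡ inj₁ i → cls x ≡ inj₂ ℓ → ⊥
    inside≢labelled eq eq′ with trans (sym eq) eq′
    ... | ()

    same-vertex : ∀ {x i i′} → cls x ≡ inj₁ i → cls x ≡ inj₁ i′ → i ≡ i′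
    same-vertex eq eq′ with trans (sym eq) eq′
    ... | refl = refl

    same-label : ∀ {x ℓ ℓ′} → cls x ≡ inj₂ ℓ → cls x ≡ inj₂ ℓ′ → ℓ ≡ ℓ′
    same-label eq eq′ with trans (sym eq) eq′
    ... | refl = refl

    -- An edge out of a part stays in it or leads to `V`, where only `v` is allowed; without
    -- repetitions, `v` can only come last.
    walk-in-part : ∀ {u v xs ℓ} → Walk _~_ u v xs → cls u ≡ inj₂ ℓ → Unique xs →
                   (∀ {e} → e ∈ₗ xs → Labelled e ⊎ e ≡ v) →
                   (∀ {e} → e ∈ₗ xs → cls e ≡ inj₂ ℓ ⊎ e ≡ v) × (∀ {j} → cls v ≡ inj₁ j → att ℓ j)
    walk-in-part [] u∈ℓ _ _ = (λ ()) , λ v∈V → ⊥-elim (inside≢labelled v∈V u∈ℓ)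
    walk-in-part (r ∷ p) u∈ℓ (_ ∷ xs!) hyp with hyp (here refl)
    ... | inj₁ (_ , w∈ℓ′) with same r u∈ℓ w∈ℓ′
    ...   | refl with walk-in-part p w∈ℓ′ xs! (hyp ∘ there)
    ...     | inℓ , v-att = (λ { (here refl) → inj₁ w∈ℓ′ ; (there e∈) → inℓ e∈ }) , v-att
    walk-in-part (r ∷ []) u∈ℓ _ hyp | inj₂ refl =
      (λ { (here refl) → inj₂ refl }) , λ v∈V → attached (~-sym r) v∈V u∈ℓ
    walk-in-part (r ∷ _ ∷ p) u∈ℓ xs! hyp | inj₂ refl = contradiction (target∈ p) (unique-head xs!)

    TrivialArc : Fin n → List (Fin n) → Set
    TrivialArc v xs = length xs ≤ 1 × (∀ {e} → e ∈ₗ xs → e ≡ v)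

    -- The first step decides: it enters a part, which the walk then leaves only at `v`, or it goes
    -- to `v` directly and the walk is over.
    arc : ∀ {u v xs i j} → Walk _~_ u v xs → cls u ≡ inj₁ i → cls v ≡ inj₁ j → Unique xs →
          (∀ {e} → e ∈ₗ xs → Labelled e ⊎ e ≡ v) →
          TrivialArc v xs ⊎ (∃[ ℓ ] att ℓ i × att ℓ j × (∀ {e} → e ∈ₗ xs → cls e ≡ inj₂ ℓ ⊎ e ≡ v))
    arc [] _ _ _ _ = inj₁ (z≤n , λ ())
    arc (r ∷ p) u∈V v∈V (w∉ ∷ xs!) hyp with hyp (here refl)
    ... | inj₁ (ℓ , w∈ℓ) with walk-in-part p w∈ℓ xs! (hyp ∘ there)
    ...   | inℓ , v-att = inj₂ (ℓ , attached r u∈V w∈ℓ , v-att v∈V , λ where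
                            (here refl) → inj₁ w∈ℓ
                            (there e∈) → inℓ e∈)
    arc (r ∷ []) _ _ _ _ | inj₂ refl = inj₁ (s≤s z≤n , λ { (here refl) → refl })
    arc (r ∷ _ ∷ p) _ _ xs! _ | inj₂ refl = contradiction (target∈ p) (unique-head xs!)

    -- A longest cycle with at most one vertex in `V` is a closed walk in one part, or an arc from
    -- that vertex back to itself through one part. Either way it is confined.
    small⇒two-inside : Small → ∀ {c} i → IsLongestCycle G c →
                       ¬ (∀ {x} → x ∈ₗ c → ∀ {j} → cls x ≡ inj₁ j → j ≡ i)
    small⇒two-inside small {c} i LC@(cyc , _) only with Any.any? inside? c
      where
      inside? : ∀ x → Dec (∃[ j ] cls x ≡ inj₁ j)
      inside? x with inside-or-labelled x
      ... | inj₁ x∈V       = yes x∈V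
      ... | inj₂ (ℓ , x∈ℓ) = no λ (_ , x∈V) → inside≢labelled x∈V x∈ℓ
    ... | no none with cycle-vertex G cyc
    ...   | x , x∈ with cycle⇒walk G cyc x∈
    ...     | xs , p , perm = small (proj₁ (lab x∈)) i c LC confined
      where
      lab : ∀ {e} → e ∈ₗ c → Labelled e
      lab {e} e∈ with inside-or-labelled e
      ... | inj₁ e∈V = contradiction (Any.map (λ { refl → e∈V }) e∈) none
      ... | inj₂ e∈L = e∈L
      confined : Confined (proj₁ (lab x∈)) i c
      confined e∈ with proj₁ (walk-in-part p (proj₂ (lab x∈)) (unique-resp-↭ (↭-sym perm) (cycle-unique G cyc))
                                (λ e∈′ → inj₁ (lab (∈-resp-↭ perm e∈′)))) (∈-resp-↭ (↭-sym perm) e∈)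
      ... | inj₁ e∈ℓ  = inj₁ e∈ℓ
      ... | inj₂ refl = inj₁ (proj₂ (lab x∈))
    small⇒two-inside small {c} i LC@(cyc , _) only | yes some with find some
    ... | x , x∈ , j , x∈V with only x∈ x∈V
    ... | refl with cycle⇒walk G cyc x∈
    ... | xs , p , perm with arc p x∈V x∈V (unique-resp-↭ (↭-sym perm) (cycle-unique G cyc)) hyp
      where
      hyp : ∀ {e} → e ∈ₗ xs → Labelled e ⊎ e ≡ x
      hyp {e} e∈ with inside-or-labelled e
      ... | inj₂ e∈L = inj₁ e∈L
      ... | inj₁ (_ , e∈V) with only (∈-resp-↭ perm e∈) e∈V
      ...   | refl = inj₂ (cls-inj e∈V x∈V)
    ... | inj₁ (≤1 , _) with ℕ.≤-trans (cycle-length G cyc) (ℕ.≤-trans (ℕ.≤-reflexive (↭-length (↭-sym perm))) ≤1)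
    ...   | s≤s ()
    small⇒two-inside small {c} i LC@(cyc , _) only | yes some | x , x∈ , j , x∈V | refl | xs , p , perm
      | inj₂ (ℓ , i-att , _ , inℓ) = small ℓ i c LC confined
      where
      confined : Confined ℓ i c
      confined e∈ with inℓ (∈-resp-↭ (↭-sym perm) e∈)
      ... | inj₁ e∈ℓ  = inj₁ e∈ℓ
      ... | inj₂ refl = inj₂ (x∈V , i-att)

  OnlyInside : ∀ {V L att} → Cover V L att → V → V → List (Fin n) → Set
  OnlyInside K a b c = ∀ {x} → x ∈ₗ c → ∀ {i} → Cover.cls K x ≡ inj₁ i → i ≡ a ⊎ i ≡ b

  module _ {m : ℕ} {L : Set} {att : L → Fin m → Set} (K : Cover (Fin m) L att) where
    open Cover K

    -- If `a` were missed, `b` would be the only possible vertex inside.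
    hits : Small → ∀ {a b c} → IsLongestCycle G c → OnlyInside K a b c → ∃[ x ] x ∈ₗ c × cls x ≡ inj₁ a
    hits small {a} {b} {c} LC only with Any.any? (λ x → at? x (inside-or-labelled x)) c
      where
      at? : ∀ x → (∃[ i ] cls x ≡ inj₁ i) ⊎ Labelled x → Dec (cls x ≡ inj₁ a)
      at? x (inj₂ (_ , x∈L)) = no λ x∈V → inside≢labelled x∈V x∈L
      at? x (inj₁ (i , x∈V)) with i Fin.≟ a
      ... | yes refl = yes x∈V
      ... | no i≢a   = no λ x∈V′ → i≢a (same-vertex x∈V x∈V′)
    ... | yes some = find some
    ... | no none  = ⊥-elim (small⇒two-inside small b LC onlyb)
      where
      onlyb : ∀ {x} → x ∈ₗ c → ∀ {j} → cls x ≡ inj₁ j → j ≡ b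
      onlyb x∈ x∈V with only x∈ x∈V
      ... | inj₂ j≡b  = j≡b
      ... | inj₁ refl = contradiction (Any.map (λ { refl → x∈V }) x∈) none

    -- For an arc that is a single edge the last condition is vacuous, so any bag vertex other than
    -- `a` and `b` serves as `w`.
    Misses : Subset m → Fin m → Fin m → List (Fin n) → Fin m → Set
    Misses B a b xs w = w ∈ₛ B × w ≢ a × w ≢ b ×
      (∀ {e ℓ} → e ∈ₗ xs → cls e ≡ inj₂ ℓ → att ℓ a × att ℓ b × ¬ att ℓ w)

    -- A longest cycle meeting the bag in a and b consists of two arcs, each
    -- running through at most one part, and each part misses a bag vertex.
    two-arcs : Small → (B : Subset m) → (∀ ℓ → ∃[ w ] w ∈ₛ B × ¬ att ℓ w) →
               ∀ {a b c} → a ≢ b → IsLongestCycle G c → OnlyInside K a b c →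
               ∃[ w₁ ] ∃[ w₂ ] ∃[ xs ] ∃[ ys ] xs ++ ys ↭ c × Misses B a b xs w₁ × Misses B a b ys w₂
    two-arcs small B missing {a} {b} {c} a≢b LC@(cyc , _) only
      with hits small LC only | hits small LC (λ x∈ x∈V → Sum.swap (only x∈ x∈V))
    ... | xa , xa∈ , xa∈V | xb , xb∈ , xb∈V with cycle⇒walk G cyc xa∈
    ... | _ , p , perm with splitWalk p (there (∈-resp-↭ (↭-sym perm) xb∈))
    ... | xs , ys , refl , p₁ , p₂ = combine
        (classify xb∈V (arc p₁ xa∈V xb∈V (proj₁ parts) hyp₁))
        (classify xa∈V (Sum.map₂ (λ (ℓ , b-att , a-att , inℓ) → ℓ , a-att , b-att , inℓ)
                                 (arc p₂ xb∈V xa∈V (proj₁ (proj₂ parts)) hyp₂)))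
      where
      xa≢xb : xa ≢ xb
      xa≢xb refl = a≢b (same-vertex xa∈V xb∈V)
      parts : Unique xs × Unique ys × Disjoint xs ys
      parts = unique-++⁻ xs (unique-resp-↭ (↭-sym perm) (cycle-unique G cyc))
      xs#ys : Disjoint xs ys
      xs#ys = proj₂ (proj₂ parts)
      end : ∀ {e} → e ∈ₗ xs ++ ys → Labelled e ⊎ (e ≡ xa ⊎ e ≡ xb)
      end {e} e∈ with inside-or-labelled e
      ... | inj₂ e∈L = inj₁ e∈L
      ... | inj₁ (_ , e∈V) with only (∈-resp-↭ perm e∈) e∈V
      ...   | inj₁ refl = inj₂ (inj₁ (cls-inj e∈V xa∈V))
      ...   | inj₂ refl = inj₂ (inj₂ (cls-inj e∈V xb∈V))
      hyp₁ : ∀ {e} → e ∈ₗ xs → Labelled e ⊎ e ≡ xb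
      hyp₁ e∈ with end (∈-++⁺ˡ e∈)
      ... | inj₁ e∈L         = inj₁ e∈L
      ... | inj₂ (inj₂ e≡)   = inj₂ e≡
      ... | inj₂ (inj₁ refl) = ⊥-elim (xs#ys (e∈ , target∈-≢ p₂ (xa≢xb ∘ sym)))
      hyp₂ : ∀ {e} → e ∈ₗ ys → Labelled e ⊎ e ≡ xa
      hyp₂ e∈ with end (∈-++⁺ʳ xs e∈)
      ... | inj₁ e∈L         = inj₁ e∈L
      ... | inj₂ (inj₁ e≡)   = inj₂ e≡
      ... | inj₂ (inj₂ refl) = ⊥-elim (xs#ys (target∈-≢ p₁ xa≢xb , e∈))

      Unlabelled : List (Fin n) → Set
      Unlabelled zs = length zs ≤ 1 × (∀ {e} → e ∈ₗ zs → ¬ Labelled e)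

      classify : ∀ {zs v j} → cls v ≡ inj₁ j →
                 TrivialArc v zs ⊎ (∃[ ℓ ] att ℓ a × att ℓ b × (∀ {e} → e ∈ₗ zs → cls e ≡ inj₂ ℓ ⊎ e ≡ v)) →
                 Unlabelled zs ⊎ (∃[ w ] Misses B a b zs w)
      classify v∈V (inj₁ (≤1 , triv)) = inj₁ (≤1 , λ e∈ (_ , e∈L) → inside≢labelled (subst (λ x → cls x ≡ _) (sym (triv e∈)) v∈V) e∈L)
      classify v∈V (inj₂ (ℓ , a-att , b-att , inℓ)) with missing ℓ
      ... | w , w∈ , ¬w-att =
        inj₂ (w , w∈ , (λ { refl → ¬w-att a-att }) , (λ { refl → ¬w-att b-att }) , λ e∈ e∈L → labels e∈L (inℓ e∈))
        where
        labels : ∀ {e ℓ′} → cls e ≡ inj₂ ℓ′ → cls e ≡ inj₂ ℓ ⊎ e ≡ _ → att ℓ′ a × att ℓ′ b × ¬ att ℓ′ w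
        labels e∈L (inj₂ refl) = ⊥-elim (inside≢labelled v∈V e∈L)
        labels e∈L (inj₁ e∈ℓ) with same-label e∈L e∈ℓ
        ... | refl = a-att , b-att , ¬w-att

      vacuous : ∀ {zs zs′ w} → Unlabelled zs → Misses B a b zs′ w → Misses B a b zs w
      vacuous (_ , none) (w∈ , w≢a , w≢b , _) = w∈ , w≢a , w≢b , λ e∈ e∈L → ⊥-elim (none e∈ (_ , e∈L))

      -- An arc without parts borrows the `w` of the other arc; both cannot be single edges, since a
      -- cycle has length at least 3.
      combine : Unlabelled xs ⊎ (∃[ w ] Misses B a b xs w) → Unlabelled ys ⊎ (∃[ w ] Misses B a b ys w) →
                ∃[ w₁ ] ∃[ w₂ ] ∃[ xs ] ∃[ ys ] xs ++ ys ↭ c × Misses B a b xs w₁ × Misses B a b ys w₂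
      combine (inj₂ (w₁ , m₁)) (inj₂ (w₂ , m₂)) = w₁ , w₂ , xs , ys , perm , m₁ , m₂
      combine (inj₂ (w , m))   (inj₁ un)         = w , w , xs , ys , perm , m , vacuous un m
      combine (inj₁ un)        (inj₂ (w , m))    = w , w , xs , ys , perm , vacuous un m , m
      combine (inj₁ (≤1 , _))  (inj₁ (≤1′ , _))
        with ℕ.≤-trans (cycle-length G cyc) (ℕ.≤-trans (ℕ.≤-reflexive (trans (↭-length (↭-sym perm)) (length-++ xs))) (ℕ.+-mono-≤ ≤1 ≤1′))
      ... | s≤s (s≤s ())

    -- If a longest cycle through a, b has arcs missing w₁, w₂, then one meeting
    -- the bag in w₁, w₂ (or in w₁, a when w₁ ≡ w₂) shares at most a with it.
    bag-contradiction : Is2Connected G → Small → (B : Subset m) → (∀ ℓ → ∃[ w ] w ∈ₛ B × ¬ att ℓ w) →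
      (∀ {a b} → a ∈ₛ B → b ∈ₛ B → a ≢ b → ¬ (∀ c → IsLongestCycle G c → ¬ OnlyInside K a b c)) →
      ∀ {a b} → a ∈ₛ B → b ∈ₛ B → a ≢ b → ⊥
    bag-contradiction conn small B missing hit {a} {b} a∈ b∈ a≢b = hit a∈ b∈ a≢b first
      where
      first : ∀ c → IsLongestCycle G c → ¬ OnlyInside K a b c
      first c LC onlyC with two-arcs small B missing a≢b LC onlyC
      ... | w₁ , w₂ , xs , ys , perm , (w₁∈ , w₁≢a , w₁≢b , miss₁) , (w₂∈ , w₂≢a , w₂≢b , miss₂) =
        second (w₁ Fin.≟ w₂)
        where
        missC : ∀ {e ℓ} → e ∈ₗ c → cls e ≡ inj₂ ℓ → ¬ att ℓ w₁ ⊎ ¬ att ℓ w₂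
        missC e∈ e∈L with ∈-++⁻ xs (∈-resp-↭ (↭-sym perm) e∈)
        ... | inj₁ e∈xs = inj₁ (proj₂ (proj₂ (miss₁ e∈xs e∈L)))
        ... | inj₂ e∈ys = inj₂ (proj₂ (proj₂ (miss₂ e∈ys e∈L)))

        attD : ∀ {p q d} → p ≢ q → IsLongestCycle G d → OnlyInside K p q d →
               ∀ {e ℓ} → e ∈ₗ d → cls e ≡ inj₂ ℓ → att ℓ p × att ℓ q
        attD p≢q LD onlyD e∈ e∈L with two-arcs small B missing p≢q LD onlyD
        ... | _ , _ , xs′ , _ , perm′ , (_ , _ , _ , m₁) , (_ , _ , _ , m₂) with ∈-++⁻ xs′ (∈-resp-↭ (↭-sym perm′) e∈)
        ...   | inj₁ e∈′ = proj₁ (m₁ e∈′ e∈L) , proj₁ (proj₂ (m₁ e∈′ e∈L))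
        ...   | inj₂ e∈′ = proj₁ (m₂ e∈′ e∈L) , proj₁ (proj₂ (m₂ e∈′ e∈L))

        second : Dec (w₁ ≡ w₂) → ⊥
        -- `c` runs through `a`, `b` and parts missing `w₁` or `w₂`, whereas `d` runs through `w₁`,
        -- `w₂` and parts attached to both. One common vertex is already impossible.
        second (no w₁≢w₂) = hit w₁∈ w₂∈ w₁≢w₂ λ d LD onlyD →
          let x , _ , _ , (x∈C , x∈D) , _ = longest-cycles-meet-twice G conn LC LD
          in common LD onlyD x∈C x∈D (inside-or-labelled x)
          where
          common : ∀ {d x} → IsLongestCycle G d → OnlyInside K w₁ w₂ d → x ∈ₗ c → x ∈ₗ d →
                   (∃[ i ] cls x ≡ inj₁ i) ⊎ Labelled x → ⊥
          common LD onlyD x∈C x∈D (inj₂ (ℓ , x∈L)) with missC x∈C x∈L | attD w₁≢w₂ LD onlyD x∈D x∈L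
          ... | inj₁ ¬att₁ | att₁ , _ = ¬att₁ att₁
          ... | inj₂ ¬att₂ | _ , att₂ = ¬att₂ att₂
          common LD onlyD x∈C x∈D (inj₁ (i , x∈V)) with onlyC x∈C x∈V | onlyD x∈D x∈V
          ... | inj₁ refl | inj₁ refl = w₁≢a refl
          ... | inj₁ refl | inj₂ refl = w₂≢a refl
          ... | inj₂ refl | inj₁ refl = w₁≢b refl
          ... | inj₂ refl | inj₂ refl = w₂≢b refl
        second (yes refl) = hit w₁∈ a∈ w₁≢a λ d LD onlyD →
          let x , y , x≢y , (x∈C , x∈D) , (y∈C , y∈D) = longest-cycles-meet-twice G conn LC LD
          in x≢y (cls-inj (common LD onlyD x∈C x∈D (inside-or-labelled x))
                          (common LD onlyD y∈C y∈D (inside-or-labelled y)))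
          where
          common : ∀ {d x} → IsLongestCycle G d → OnlyInside K w₁ a d → x ∈ₗ c → x ∈ₗ d →
                   (∃[ i ] cls x ≡ inj₁ i) ⊎ Labelled x → cls x ≡ inj₁ a
          common LD onlyD x∈C x∈D (inj₂ (ℓ , x∈L)) with missC x∈C x∈L | attD w₁≢a LD onlyD x∈D x∈L
          ... | inj₁ ¬att₁ | att₁ , _ = ⊥-elim (¬att₁ att₁)
          ... | inj₂ ¬att₁ | att₁ , _ = ⊥-elim (¬att₁ att₁)
          common LD onlyD x∈C x∈D (inj₁ (i , x∈V)) with onlyD x∈D x∈V
          ... | inj₂ refl = x∈V
          ... | inj₁ refl with onlyC x∈C x∈V
          ...   | inj₁ refl = x∈V
          ...   | inj₂ refl = contradiction refl w₁≢b

  -- Peeling the last vertex off a k-tree.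

  -- H is what remains of a k-tree containing G after some vertices have been
  -- peeled off; the peeled vertices form parts attached to cliques of H.
  record Peeling (k : ℕ) {j : ℕ} (H : Graph j) : Set₁ where
    field
      Label  : Set
      clique : Label → Subset j
      cover  : Cover (Fin j) Label (λ ℓ i → i ∈ₛ clique ℓ)
    open Cover cover public
    field
      edge      : ∀ {x y i i′} → x ~ y → cls x ≡ inj₁ i → cls y ≡ inj₁ i′ → Graph._~_ H i i′
      is-clique : ∀ ℓ → IsClique H (clique ℓ)
      size      : ∀ ℓ → ∣ clique ℓ ∣ ≤ k
      small     : Small
      -- Double negation of: some longest cycle avoids `X`. This weak form suffices because it is
      -- only used to derive absurdity.
      escape    : ∀ X → ∣ X ∣ < k →
                  ¬ (∀ c → IsLongestCycle G c → ¬ (∀ {x} → x ∈ₗ c → ∀ {i} → cls x ≡ inj₁ i → i ∉ₛ X))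

  module Extension {k j : ℕ} {H : Graph j} {H⁺ : Graph (suc j)} (v : Fin (suc j)) (Q : Subset j)
    (Q-clique : IsClique H Q) (∣Q∣≡ : ∣ Q ∣ ≡ suc k)
    (old : ∀ i i′ → Graph._~_ H⁺ (punchIn v i) (punchIn v i′) ⇔ Graph._~_ H i i′)
    (new : ∀ i → Graph._~_ H⁺ v (punchIn v i) ⇔ i ∈ₛ Q)
    (conn : Is2Connected G) (P : Peeling (suc k) H⁺) where

    open Peeling P

    B : Subset (suc j)
    B = Vec.insertAt Q v true

    v∈B : v ∈ₛ B
    v∈B = Vec.lookup⇒[]= v B (Vec.insertAt-lookup Q v true)

    ∣B∣≡ : ∣ B ∣ ≡ suc (suc k)
    ∣B∣≡ = trans (∣insertAt-inside∣ Q v) (cong suc ∣Q∣≡)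

    neighbour∈B : ∀ {i} → Graph._~_ H⁺ v i → i ∈ₛ B
    neighbour∈B {i} vi with punchIn-view v i
    ... | inj₁ refl       = v∈B
    ... | inj₂ (i′ , refl) = ∈-insertAt⁺ Q v true (Equivalence.to (new i′) vi)

    clique⊆B : ∀ {ℓ i} → v ∈ₛ clique ℓ → i ∈ₛ clique ℓ → i ∈ₛ B
    clique⊆B {ℓ} {i} v∈ i∈ with v Fin.≟ i
    ... | yes refl = v∈B
    ... | no v≢i   = neighbour∈B (is-clique ℓ v∈ i∈ v≢i)

    -- `B` has `suc (suc k)` elements, so without `a` and `b` it is small enough for `escape`.
    escape-pair : ∀ {a b} → a ∈ₛ B → b ∈ₛ B → a ≢ b →
                  ¬ (∀ c → IsLongestCycle G c → ¬ (∀ {x} → x ∈ₗ c → ∀ {i} → cls x ≡ inj₁ i → i ∈ₛ B → i ≡ a ⊎ i ≡ b))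
    escape-pair {a} {b} a∈ b∈ a≢b none = escape (B ∖ a ∖ b) small-card λ c LC off → none c LC λ x∈ x∈V i∈ → pin (off x∈ x∈V) i∈
      where
      b∈′ : b ∈ₛ B ∖ a
      b∈′ = Subset.x∈p∧x≢y⇒x∈p-y b∈ (a≢b ∘ sym)
      small-card : ∣ B ∖ a ∖ b ∣ < suc k
      small-card = ℕ.<-≤-trans (Subset.x∈p⇒∣p-x∣<∣p∣ b∈′)
        (ℕ.≤-pred (ℕ.≤-trans (Subset.x∈p⇒∣p-x∣<∣p∣ a∈) (ℕ.≤-reflexive ∣B∣≡)))
      pin : ∀ {i} → i ∉ₛ B ∖ a ∖ b → i ∈ₛ B → i ≡ a ⊎ i ≡ b
      pin {i} i∉ i∈ with i Fin.≟ a | i Fin.≟ b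
      ... | yes i≡a | _       = inj₁ i≡a
      ... | no _    | yes i≡b = inj₂ i≡b
      ... | no i≢a  | no i≢b  = contradiction (Subset.x∈p∧x≢y⇒x∈p-y (Subset.x∈p∧x≢y⇒x∈p-y i∈ i≢a) i≢b) i∉

    -- Peeling v merges v and the parts attached to it into the part nothing.
    peel : Fin (suc j) ⊎ Label → Fin j ⊎ Maybe Label
    peel (inj₁ i) with v Fin.≟ i
    ... | yes _  = inj₂ nothing
    ... | no v≢i = inj₁ (punchOut v≢i)
    peel (inj₂ ℓ) with v Subset.∈? clique ℓ
    ... | yes _ = inj₂ nothing
    ... | no _  = inj₂ (just ℓ)

    peel-inside : ∀ s {i} → peel s ≡ inj₁ i → s ≡ inj₁ (punchIn v i)
    peel-inside (inj₁ i) eq with v Fin.≟ i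
    peel-inside (inj₁ i) refl | no v≢i = cong inj₁ (sym (Fin.punchIn-punchOut v≢i))
    peel-inside (inj₂ ℓ) eq with v Subset.∈? clique ℓ
    peel-inside (inj₂ ℓ) () | yes _
    peel-inside (inj₂ ℓ) () | no _

    peel-just : ∀ s {ℓ} → peel s ≡ inj₂ (just ℓ) → s ≡ inj₂ ℓ × v ∉ₛ clique ℓ
    peel-just (inj₁ i) eq with v Fin.≟ i
    peel-just (inj₁ i) () | yes _
    peel-just (inj₁ i) () | no _
    peel-just (inj₂ ℓ) eq with v Subset.∈? clique ℓ
    peel-just (inj₂ ℓ) refl | no v∉ = refl , v∉

    peel-nothing : ∀ s → peel s ≡ inj₂ nothing → s ≡ inj₁ v ⊎ (∃[ ℓ ] s ≡ inj₂ ℓ × v ∈ₛ clique ℓ)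
    peel-nothing (inj₁ i) eq with v Fin.≟ i
    ... | yes refl = inj₁ refl
    peel-nothing (inj₂ ℓ) eq with v Subset.∈? clique ℓ
    ... | yes v∈ = inj₂ (ℓ , refl , v∈)

    -- Keeping only the bag B merges everything outside B that is not in a part
    -- attached to v into the part nothing.
    bag : Fin (suc j) ⊎ Label → Fin (suc j) ⊎ Maybe Label
    bag (inj₁ i) with i Subset.∈? B
    ... | yes _ = inj₁ i
    ... | no _  = inj₂ nothing
    bag (inj₂ ℓ) with v Subset.∈? clique ℓ
    ... | yes _ = inj₂ (just ℓ)
    ... | no _  = inj₂ nothing

    bag-inside : ∀ s {i} → bag s ≡ inj₁ i → s ≡ inj₁ i × i ∈ₛ B
    bag-inside (inj₁ i) eq with i Subset.∈? B
    bag-inside (inj₁ i) refl | yes i∈ = refl , i∈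
    bag-inside (inj₂ ℓ) eq with v Subset.∈? clique ℓ
    bag-inside (inj₂ ℓ) () | yes _
    bag-inside (inj₂ ℓ) () | no _

    bag-just : ∀ s {ℓ} → bag s ≡ inj₂ (just ℓ) → s ≡ inj₂ ℓ × v ∈ₛ clique ℓ
    bag-just (inj₁ i) eq with i Subset.∈? B
    bag-just (inj₁ i) () | yes _
    bag-just (inj₁ i) () | no _
    bag-just (inj₂ ℓ) eq with v Subset.∈? clique ℓ
    bag-just (inj₂ ℓ) refl | yes v∈ = refl , v∈

    bag-nothing : ∀ s → bag s ≡ inj₂ nothing →
                  (∃[ i ] s ≡ inj₁ i × i ∉ₛ B) ⊎ (∃[ ℓ ] s ≡ inj₂ ℓ × v ∉ₛ clique ℓ)
    bag-nothing (inj₁ i) eq with i Subset.∈? B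
    ... | no i∉ = inj₁ (i , refl , i∉)
    bag-nothing (inj₂ ℓ) eq with v Subset.∈? clique ℓ
    ... | no v∉ = inj₂ (ℓ , refl , v∉)

    -- The part `nothing` has no edge to `v`: neighbours of `v` in `H⁺` lie in `B`, and parts
    -- attached to `v` keep their own labels.
    bag-att : Maybe Label → Fin (suc j) → Set
    bag-att nothing  i = i ≢ v
    bag-att (just ℓ) i = i ∈ₛ clique ℓ

    bag-attached : ∀ {x y i m} → x ~ y → bag (cls x) ≡ inj₁ i → bag (cls y) ≡ inj₂ m → bag-att m i
    bag-attached {m = just ℓ} xy bx by = attached xy (proj₁ (bag-inside _ bx)) (proj₁ (bag-just _ by))
    bag-attached {m = nothing} xy bx by refl with bag-nothing _ by
    ... | inj₁ (_ , y∈V , i∉B) = i∉B (neighbour∈B (edge xy (proj₁ (bag-inside _ bx)) y∈V))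
    ... | inj₂ (_ , y∈ℓ , v∉)  = v∉ (attached xy (proj₁ (bag-inside _ bx)) y∈ℓ)

    -- A part attached to `v` has its whole clique inside `B`, so it touches neither a vertex
    -- outside `B` nor another part.
    bag-separate : ∀ {x y ℓ} → x ~ y → bag (cls x) ≡ inj₂ (just ℓ) → bag (cls y) ≡ inj₂ nothing → ⊥
    bag-separate xy bx by with bag-just _ bx | bag-nothing _ by
    ... | x∈ℓ , v∈ | inj₁ (_ , y∈V , i∉B) = i∉B (clique⊆B v∈ (attached (~-sym xy) y∈V x∈ℓ))
    ... | x∈ℓ , v∈ | inj₂ (_ , y∈ℓ , v∉) with same xy x∈ℓ y∈ℓ
    ...   | refl = v∉ v∈

    bag-same : ∀ {x y m m′} → x ~ y → bag (cls x) ≡ inj₂ m → bag (cls y) ≡ inj₂ m′ → m ≡ m′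
    bag-same {m = just _}  {just _}  xy bx by = cong just (same xy (proj₁ (bag-just _ bx)) (proj₁ (bag-just _ by)))
    bag-same {m = nothing} {nothing} xy bx by = refl
    bag-same {m = just _}  {nothing} xy bx by = ⊥-elim (bag-separate xy bx by)
    bag-same {m = nothing} {just _}  xy bx by = ⊥-elim (bag-separate (~-sym xy) by bx)

    bag-cover : Cover (Fin (suc j)) (Maybe Label) bag-att
    bag-cover = record
      { cls      = bag ∘ cls
      ; cls-inj  = λ bx by → cls-inj (proj₁ (bag-inside _ bx)) (proj₁ (bag-inside _ by))
      ; attached = bag-attached
      ; same     = bag-same
      }

    -- The clique of a part has at most `suc k` vertices, one fewer than `B`.
    missing : ∀ m → ∃[ w ] w ∈ₛ B × ¬ bag-att m w
    missing nothing  = v , v∈B , λ v≢v → v≢v refl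
    missing (just ℓ) = smaller-misses (clique ℓ) B (ℕ.≤-trans (s≤s (size ℓ)) (ℕ.≤-reflexive (sym ∣B∣≡)))

    peel-att : Maybe Label → Subset j
    peel-att nothing  = Q
    peel-att (just ℓ) = preimage (punchIn v) (clique ℓ)

    -- A remaining vertex next to the new part is adjacent to `v` in `H⁺`, either by the edge itself
    -- or because both lie in the clique of a merged part; hence it lies in `Q`.
    peel-attached : ∀ {x y i m} → x ~ y → peel (cls x) ≡ inj₁ i → peel (cls y) ≡ inj₂ m → i ∈ₛ peel-att m
    peel-attached {m = just ℓ} xy bx by =
      ∈-preimage⁺ (punchIn v) (attached xy (peel-inside _ bx) (proj₁ (peel-just _ by)))
    peel-attached {i = i} {m = nothing} xy bx by with peel-nothing _ by
    ... | inj₁ y≡v = Equivalence.to (new i) (edge (~-sym xy) y≡v (peel-inside _ bx))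
    ... | inj₂ (ℓ , y∈ℓ , v∈) = Equivalence.to (new i)
            (is-clique ℓ v∈ (attached xy (peel-inside _ bx) y∈ℓ) (Fin.punchInᵢ≢i v i ∘ sym))

    peel-separate : ∀ {x y ℓ} → x ~ y → peel (cls x) ≡ inj₂ (just ℓ) → peel (cls y) ≡ inj₂ nothing → ⊥
    peel-separate xy bx by with peel-just _ bx | peel-nothing _ by
    ... | x∈ℓ , v∉ | inj₁ y≡v = v∉ (attached (~-sym xy) y≡v x∈ℓ)
    ... | x∈ℓ , v∉ | inj₂ (_ , y∈ℓ , v∈) with same xy x∈ℓ y∈ℓ
    ...   | refl = v∉ v∈

    peel-same : ∀ {x y m m′} → x ~ y → peel (cls x) ≡ inj₂ m → peel (cls y) ≡ inj₂ m′ → m ≡ m′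
    peel-same {m = just _}  {just _}  xy bx by = cong just (same xy (proj₁ (peel-just _ bx)) (proj₁ (peel-just _ by)))
    peel-same {m = nothing} {nothing} xy bx by = refl
    peel-same {m = just _}  {nothing} xy bx by = ⊥-elim (peel-separate xy bx by)
    peel-same {m = nothing} {just _}  xy bx by = ⊥-elim (peel-separate (~-sym xy) by bx)

    peel-cover : Cover (Fin j) (Maybe Label) (λ m i → i ∈ₛ peel-att m)
    peel-cover = record
      { cls      = peel ∘ cls
      ; cls-inj  = λ bx by → cls-inj (peel-inside _ bx) (peel-inside _ by)
      ; attached = peel-attached
      ; same     = peel-same
      }

    -- A longest cycle c₀ confined to the new part meets any longest cycle
    -- confined to the complementary part of the bag cover in at most one vertex.
    bag-small : ∀ {i₀ c₀} → IsLongestCycle G c₀ → Cover.Confined peel-cover nothing i₀ c₀ → Cover.Small bag-cover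
    bag-small _ _ (just ℓ) i c LC conf = small ℓ i c LC λ x∈ → Sum.map
      (λ bx → proj₁ (bag-just _ bx)) (λ (bx , i-att) → proj₁ (bag-inside _ bx) , i-att) (conf x∈)
    bag-small {i₀} {c₀} LC₀ conf₀ nothing i c LC conf =
      let x , y , x≢y , (x∈c₀ , x∈c) , (y∈c₀ , y∈c) = longest-cycles-meet-twice G conn LC₀ LC
      in x≢y (Cover.cls-inj bag-cover (inside x∈c₀ x∈c) (inside y∈c₀ y∈c))
      where
      -- `c₀` uses only `v`, parts attached to `v`, and `i₀` in `Q`; none of these falls into the
      -- complementary part.
      not-nothing : ∀ {x} → x ∈ₗ c₀ → bag (cls x) ≢ inj₂ nothing
      not-nothing {x} x∈ bx with conf₀ x∈ | bag-nothing _ bx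
      ... | inj₂ (px , i₀∈Q) | inj₁ (_ , x∈V , i∉B) with same-vertex {x} x∈V (peel-inside _ px)
      ...   | refl = i∉B (∈-insertAt⁺ Q v true i₀∈Q)
      not-nothing {x} x∈ bx | inj₂ (px , _) | inj₂ (_ , x∈ℓ , _) = inside≢labelled {x} (peel-inside _ px) x∈ℓ
      not-nothing {x} x∈ bx | inj₁ px | inj₁ (_ , x∈V , i∉B) with peel-nothing _ px
      ... | inj₂ (_ , x∈ℓ , _) = inside≢labelled {x} x∈V x∈ℓ
      ... | inj₁ x≡v with same-vertex {x} x∈V x≡v
      ...   | refl = i∉B v∈B
      not-nothing {x} x∈ bx | inj₁ px | inj₂ (_ , x∈ℓ , v∉) with peel-nothing _ px
      ... | inj₁ x≡v = inside≢labelled {x} x≡v x∈ℓ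
      ... | inj₂ (_ , x∈ℓ′ , v∈) with same-label {x} x∈ℓ x∈ℓ′
      ...   | refl = v∉ v∈
      inside : ∀ {x} → x ∈ₗ c₀ → x ∈ₗ c → bag (cls x) ≡ inj₁ i
      inside x∈c₀ x∈c with conf x∈c
      ... | inj₁ bx       = contradiction bx (not-nothing x∈c₀)
      ... | inj₂ (bx , _) = bx

    peel-small : Cover.Small peel-cover
    peel-small (just ℓ) i c LC conf = small ℓ (punchIn v i) c LC λ x∈ → Sum.map
      (λ px → proj₁ (peel-just _ px)) (λ (px , i-att) → peel-inside _ px , ∈-preimage⁻ (punchIn v) i-att) (conf x∈)
    peel-small nothing i₀ c₀ LC₀ conf₀
      -- The bag argument needs one pair to start from: `v` and any other element of `B`, which has
      -- at least two.
      with smaller-misses ⁅ v ⁆ B (ℕ.≤-trans (s≤s (ℕ.≤-trans (ℕ.≤-reflexive (Subset.∣⁅x⁆∣≡1 v)) (s≤s z≤n))) (ℕ.≤-reflexive (sym ∣B∣≡)))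
    ... | b , b∈B , b∉⁅v⁆ =
      bag-contradiction bag-cover conn (bag-small LC₀ conf₀) B missing
        (λ a∈ b∈ a≢b none → escape-pair a∈ b∈ a≢b λ c LC only → none c LC λ x∈ bx →
          let x∈V , i∈B = bag-inside _ bx in only x∈ x∈V i∈B)
        v∈B b∈B (λ { refl → b∉⁅v⁆ (Subset.x∈⁅x⁆ v) })

    peeled : Peeling (suc k) H
    peeled = record
      { Label     = Maybe Label
      ; clique    = peel-att
      ; cover     = peel-cover
      ; edge      = λ xy px py → Equivalence.to (old _ _) (edge xy (peel-inside _ px) (peel-inside _ py))
      ; is-clique = λ where
          nothing  → Q-clique
          (just ℓ) → λ i∈ i′∈ i≢i′ → Equivalence.to (old _ _)
            (is-clique ℓ (∈-preimage⁻ (punchIn v) i∈) (∈-preimage⁻ (punchIn v) i′∈) (i≢i′ ∘ Fin.punchIn-injective v _ _))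
      ; size      = λ where
          nothing  → ℕ.≤-reflexive ∣Q∣≡
          (just ℓ) → ℕ.≤-trans (∣preimage∣≤ (punchIn v) (Fin.punchIn-injective v _ _) (clique ℓ)) (size ℓ)
      ; small     = peel-small
      -- `X` is lifted without `v`, which keeps its size.
      ; escape    = λ X X< none → escape (Vec.insertAt X v false)
          (ℕ.≤-<-trans (ℕ.≤-reflexive (∣insertAt-outside∣ X v)) X<)
          λ c LC off → none c LC λ x∈ px i∈X → off x∈ (peel-inside _ px) (∈-insertAt⁺ X v false i∈X)
      }

  -- The final clique, the initial peeling and the bound.

  no-peeling : ∀ {k j} {H : Graph j} → Is2Connected G → IsKTree (suc k) H → ¬ Peeling (suc k) H
  no-peeling conn (extend t v Q Q-clique ∣Q∣≡ old new) P =
    no-peeling conn t (Extension.peeled v Q Q-clique ∣Q∣≡ old new conn P)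
  -- All vertices but `zero` number `k`, so some longest cycle avoids them and has at most one
  -- vertex inside.
  no-peeling {k} conn (complete _) P = escape (full ∖ zero)
    (ℕ.<-≤-trans (Subset.x∈p⇒∣p-x∣<∣p∣ {x = zero} {p = full {suc k}} Subset.∈⊤) (ℕ.≤-reflexive (Subset.∣⊤∣≡n (suc k))))
    λ c LC off → small⇒two-inside small zero LC λ x∈ x∈V → is-zero (off x∈ x∈V)
    where
    open Peeling P
    is-zero : ∀ {i} → i ∉ₛ full ∖ zero → i ≡ zero
    is-zero {i} i∉ with i Fin.≟ zero
    ... | yes i≡0 = i≡0
    ... | no i≢0  = contradiction (Subset.x∈p∧x≢y⇒x∈p-y Subset.∈⊤ i≢0) i∉

  transversal⇒lct≤ : ∀ S → IsLongestCycleTransversal G S → lct G ≤ ∣ S ∣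
  transversal⇒lct≤ S trans-S = proj₂ (lct-isLeast G) ∣ S ∣ (S , trans-S , refl)

  -- With nothing peeled there are no parts. A set of at most `k` vertices of `H` pulls back along
  -- `f` to a set too small to be a transversal.
  initial-peeling : ∀ {k m} {H : Graph m} → IsSubgraphOf G H → k < lct G → Peeling (suc k) H
  initial-peeling {k} (f , f-inj , f-edge) k<lct = record
    { Label     = ⊥
    ; clique    = λ ()
    ; cover     = record
        { cls      = inj₁ ∘ f
        ; cls-inj  = λ { refl fy≡fx → f-inj (sym (inj₁-injective fy≡fx)) }
        ; attached = λ { {ℓ = ()} }
        ; same     = λ { {ℓ = ()} }
        }
    ; edge      = λ { xy refl refl → f-edge xy }
    ; is-clique = λ ()
    ; size      = λ ()
    ; small     = λ ()
    ; escape    = λ X X< none → ℕ.<⇒≱ k<lct (ℕ.≤-trans (transversal⇒lct≤ (preimage f X) (transversal X none))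
                    (ℕ.≤-trans (∣preimage∣≤ f f-inj X) (ℕ.≤-pred X<)))
    }
    where
    transversal : ∀ X → (∀ c → IsLongestCycle G c → ¬ (∀ {x} → x ∈ₗ c → ∀ {i} → inj₁ (f x) ≡ inj₁ {B = ⊥} i → i ∉ₛ X)) →
                  IsLongestCycleTransversal G (preimage f X)
    transversal X none c LC with Any.any? (Subset._∈? preimage f X) c
    ... | yes hit = hit
    ... | no miss = ⊥-elim (none c LC λ { x∈ refl fx∈X → miss (Any.map (λ { refl → ∈-preimage⁺ f fx∈X }) x∈) })

-- Each new vertex is attached to an empty clique and is therefore isolated.
0-tree-edgeless : ∀ {m} {H : Graph m} → IsKTree 0 H → ∀ i i′ → ¬ Graph._~_ H i i′
0-tree-edgeless {H = H} (extend t v Q _ ∣Q∣≡0 old new) i i′ ii′ with punchIn-view v i | punchIn-view v i′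
... | inj₁ refl       | inj₁ refl        = Graph.~-irrefl H ii′
... | inj₂ (_ , refl) | inj₂ (_ , refl)  = 0-tree-edgeless t _ _ (Equivalence.to (old _ _) ii′)
... | inj₁ refl       | inj₂ (j , refl)  = ℕ.n≮0 (subst (∣ Q ∖ j ∣ <_) ∣Q∣≡0 (Subset.x∈p⇒∣p-x∣<∣p∣ (Equivalence.to (new j) ii′)))
... | inj₂ (j , refl) | inj₁ refl        = ℕ.n≮0 (subst (∣ Q ∖ j ∣ <_) ∣Q∣≡0 (Subset.x∈p⇒∣p-x∣<∣p∣ (Equivalence.to (new j) (Graph.~-sym H ii′))))

theorem6p2 : ∀ (k : ℕ) {n : ℕ} (G : Graph n) → Is2Connected G → IsPartialKTree k G → lct G ≤ k ∸ 1
theorem6p2 zero {n} G conn (_ , _ , tree , _ , _ , f-edge) =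
  -- `0 ∸ 1` is `0`, so the empty set must be a transversal; it is, as `G` has no edges and hence no
  -- cycles.
  ℕ.≤-trans (transversal⇒lct≤ G ∅ λ c (cyc , _) → ⊥-elim (no-cycle c cyc)) (ℕ.≤-reflexive (Subset.∣⊥∣≡0 n))
  where
  no-cycle : ∀ c → ¬ IsCycle G c
  no-cycle (x ∷ [])    (s≤s () , _)
  no-cycle (x ∷ y ∷ _) (_ , _ , xy ∷ _) = 0-tree-edgeless tree _ _ (f-edge xy)
theorem6p2 (suc k) G conn (_ , _ , tree , sub) with lct G ℕ.≤? k
... | yes lct≤k = lct≤k
... | no lct≰k  = contradiction (initial-peeling G sub (ℕ.≰⇒> lct≰k)) (no-peeling G conn tree)
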